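{- Consider a $\{0,L\}$-instance of the capacitated $k$-center problem with vertex set $V$, metric $c$ and capacities $L(\cdot)$, and let $\tau\geq 0$. Let $G_{\leq\tau}$ be the graph on $V$ (with a loop at every vertex) in which $u,v$ are adjacent iff $c(u,v)\leq\tau$, and let $G'$ be obtained from $G_{\leq\tau}$ by removing every edge both of whose endpoints have capacity $0$. Let $G^*=(V^*,E^*)$ be a connected component of $G'$, and suppose $\mathrm{LP}_k(G^*)$ is feasible for some integer $k$. Then there is an algorithm that computes a set of $k$ vertices of $V^*$ to open and an assignment of every vertex $u\in V^*$ to an open center $v$ such that $d_{G^*}(u,v)\leq 6$ and every open center $v$ is assigned at most its capacity many vertices.
   Context: A $\{0,L\}$-instance is one where every vertex capacity is either $0$ or $L$ for some integer $L$. For a graph $H=(V^*,E^*)$ with capacities, $\mathrm{LP}_k(H)$ is the feasibility linear program in variables $x_{uv}$ and $y_u$ ($u,v\in V^*$): $\sum_u y_u=k$; $x_{uv}\leq y_u$; $\sum_{v:(u,v)\in E^*}x_{uv}\leq L(u)y_u$ for all $u$; $\sum_{u:(u,v)\in E^*}x_{uv}=1$ for all $v$; $0\leq x,y\leq1$. $d_{G^*}$ denotes shortest-path distance in $G^*$.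
   Formalization: The metric c, the threshold τ and the LP variables x, y are taken to be rational rather than real. -}

module Defs where

open import Data.Nat as ℕ using (ℕ; zero; suc)
open import Data.Fin using (Fin)
open import Data.Fin.Subset using (Subset; _∈_)
open import Data.Fin.Subset.Properties using (_∈?_)
open import Data.Rational using (ℚ; 0ℚ; _≤_; _+_; _*_)
open import Data.Rational.Properties using (_≤?_)
open import Data.Product using (_×_; _,_; ∃; ∃-syntax; Σ)
open import Data.Sum using (_⊎_)
open import Data.Bool using (if_then_else_)
open import Relation.Nullary using (¬_; Dec; yes; no; ⌊_⌋)
open import Relation.Nullary.Decidable using (_×-dec_; _⊎-dec_; ¬?)
open import Relation.Binary.PropositionalEquality using (_≡_)

record IsMetric {n : ℕ} (c : Fin n → Fin n → ℚ) : Set where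
  field
    nonneg : ∀ u v → 0ℚ ≤ c u v
    refl0  : ∀ u → c u u ≡ 0ℚ
    sym    : ∀ u v → c u v ≡ c v u
    tri    : ∀ u v w → c u w ≤ c u v + c v w

ZeroLInstance : {n : ℕ} → (L : ℕ) → (cap : Fin n → ℕ) → Set
ZeroLInstance L cap = ∀ v → cap v ≡ 0 ⊎ cap v ≡ L

-- Edges of G_{≤τ} (with loops: c u u = 0 ≤ τ).
AdjLe : {n : ℕ} → (Fin n → Fin n → ℚ) → ℚ → Fin n → Fin n → Set
AdjLe c τ u v = c u v ≤ τ

AdjG' : {n : ℕ} → (Fin n → Fin n → ℚ) → (Fin n → ℕ) → ℚ → Fin n → Fin n → Set
AdjG' c cap τ u v = AdjLe c τ u v × (¬ (cap u ≡ 0) ⊎ ¬ (cap v ≡ 0))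

adjG'? : {n : ℕ} (c : Fin n → Fin n → ℚ) (cap : Fin n → ℕ) (τ : ℚ) →
         ∀ u v → Dec (AdjG' c cap τ u v)
adjG'? c cap τ u v =
  (c u v ≤? τ) ×-dec (¬? (cap u ℕ.≟ 0) ⊎-dec ¬? (cap v ℕ.≟ 0))

AdjIn : {n : ℕ} → (Fin n → Fin n → Set) → Subset n → Fin n → Fin n → Set
AdjIn E S u v = u ∈ S × v ∈ S × E u v

data Walk {n : ℕ} (E : Fin n → Fin n → Set) : ℕ → Fin n → Fin n → Set where
  here : ∀ {u} → Walk E 0 u u
  step : ∀ {m u w v} → E u w → Walk E m w v → Walk E (suc m) u v

DistLe : {n : ℕ} → (Fin n → Fin n → Set) → Fin n → Fin n → ℕ → Set
DistLe E u v d = ∃[ m ] (m ℕ.≤ d × Walk E m u v)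

Connected : {n : ℕ} → (Fin n → Fin n → Set) → Fin n → Fin n → Set
Connected E u v = ∃[ m ] Walk E m u v

IsComponent : {n : ℕ} → (Fin n → Fin n → Set) → Subset n → Set
IsComponent {n} E S =
  (∃[ v ] v ∈ S)
  × (∀ u v → u ∈ S → E u v → v ∈ S)
  × (∀ u v → u ∈ S → v ∈ S → Connected (AdjIn E S) u v)

sumIf : (n : ℕ) {P : Fin n → Set} → (∀ i → Dec (P i)) → (Fin n → ℚ) → ℚ
sumIf zero    P? f = 0ℚ
sumIf (suc n) P? f =
  (if ⌊ P? Fin.zero ⌋ then f Fin.zero else 0ℚ) + sumIf n (λ i → P? (Fin.suc i)) (λ i → f (Fin.suc i))
  where import Data.Fin as Fin

countIf : (n : ℕ) {P : Fin n → Set} → (∀ i → Dec (P i)) → ℕ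
countIf zero    P? = 0
countIf (suc n) P? =
  (if ⌊ P? Fin.zero ⌋ then 1 else 0) ℕ.+ countIf n (λ i → P? (Fin.suc i))
  where import Data.Fin as Fin

ℕtoℚ : ℕ → ℚ
ℕtoℚ k = Data.Integer.+ k Data.Rational./ 1
  where import Data.Rational; import Data.Integer

-- Feasibility of LP_k(H) for H = induced subgraph of G' on S, edge set E
-- (x u v for an edge (u,v) ∈ E*; variables for non-edges are unused).
LPFeasible : {n : ℕ} → (E : Fin n → Fin n → Set) → (∀ u v → Dec (E u v)) →
             Subset n → (Fin n → ℕ) → ℕ → Set
LPFeasible {n} E E? S cap k =
  Σ (Fin n → Fin n → ℚ) λ x → Σ (Fin n → ℚ) λ y →
    (sumIf n (λ u → u ∈? S) y ≡ ℕtoℚ k)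
    × (∀ u v → u ∈ S → v ∈ S → x u v ≤ y u)
    × (∀ u → u ∈ S →
         sumIf n (λ v → (v ∈? S) ×-dec E? u v) (x u) ≤ ℕtoℚ (cap u) * y u)
    × (∀ v → v ∈ S →
         sumIf n (λ u → (u ∈? S) ×-dec E? u v) (λ u → x u v) ≡ Data.Rational.1ℚ)
    × (∀ u v → u ∈ S → v ∈ S → 0ℚ ≤ x u v × x u v ≤ Data.Rational.1ℚ)
    × (∀ u → u ∈ S → 0ℚ ≤ y u × y u ≤ Data.Rational.1ℚ)
  where import Data.Rational; import Data.Integer

{-# OPTIONS --safe #-}
-- Scale the LP by a common denominator D, so that a vertex u of positive capacity owns Y u ≤ D tokens; every
-- closed neighbourhood N(w), restricted to positive capacities, holds at least D tokens. If all tokens can be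
-- sent along at most 5 edges to at most k distinct vertices of positive capacity, each receiving at most D
-- tokens, then a set B of demands, which is served by at least D∣B∣/L tokens owned by neighbours of B, sees at
-- least ∣B∣/L opened vertices within distance 6, and Hall's theorem yields the integral assignment.
--
-- To route the tokens, pick centres m (of either capacity) with disjoint N(m), each new centre being joined by
-- a path w – x – m to a vertex w ∈ N(m') of an earlier centre m'; this is possible until every N(x) meets some
-- N(m), since an undominated m has a dominated neighbour x. Reserve D tokens of N(m), the units of m,
-- for a delegate of positive capacity (m itself or x, as there is no edge between zero capacities), at
-- distance ≤ 2 from w. Clusters are dissolved from the newest to the oldest. Each one fills its spare locations
-- with D tokens each, and whatever remains is passed to the bucket of w in the parent cluster as units of m
-- together with the delegate as a location. Only units ever move up, and only once, hence the bound 5.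
module Submission where

open import Defs
open import Data.Nat using (ℕ; _≤_)
open import Data.Fin using (Fin)
open import Data.Fin.Subset using (Subset; _∈_; _⊆_; ∣_∣)
open import Data.Fin.Subset.Properties using (_∈?_)
open import Data.Rational using (ℚ; 0ℚ) renaming (_≤_ to _≤ℚ_)
open import Data.Product using (_×_; Σ)
open import Relation.Nullary.Decidable using (_×-dec_)
open import Relation.Binary.PropositionalEquality using (_≡_)
open import Data.Fin using (_≟_)

open import Data.Bool using (if_then_else_)
open import Data.Empty using (⊥-elim)
open import Data.Fin using (zero; suc)
open import Data.Fin.Properties using (any?)
open import Data.Fin.Subset using (inside; outside; _∉_; _∪_; _─_; _-_; ⁅_⁆)
open import Data.Fin.Subset.Properties
  using (_⊆?_; nonempty?; anySubset?; x∈⁅x⁆; x∈⁅y⁆⇒x≡y; p⊆p∪q; q⊆p∪q; x∈p∪q⁻; x∈p∧x∉q⇒x∈p─q; p─q⊆p;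
         x∈p∧x≢y⇒x∈p-y; drop-∷-⊆; p⊆q⇒∣p∣≤∣q∣; out⊆; s⊆s)
import Data.Integer as ℤ
import Data.Integer.Properties as ℤ
open import Data.List using (List; []; _∷_; _++_; map; length; take; drop; filter; replicate; allFin; tabulate)
open import Data.List.Membership.Propositional using () renaming (_∈_ to _∈ₗ_; _∉_ to _∉ₗ_)
open import Data.List.Membership.Propositional.Properties using (∈-filter⁺; ∈-filter⁻; ∈-allFin; ∈-∃++)
open import Data.List.Properties
  using (map-++; length-++; length-take; take++drop≡id; length-replicate; filter-notAll; map-tabulate)
open import Data.List.Relation.Unary.All as All using (All; []; _∷_)
import Data.List.Relation.Unary.All.Properties as All
open import Data.List.Relation.Unary.Any as Any using (Any; here; there)
import Data.List.Relation.Unary.Any.Properties as Any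
open import Data.Nat as ℕ using (zero; suc; _+_; _*_; _∸_; _⊓_; _<_; z≤n; s≤s; _≤?_; _<?_)
open import Data.Nat.Coprimality as Coprime using (1-coprimeTo)
open import Data.Nat.ListAction using (sum)
open import Data.Nat.ListAction.Properties using (sum-++)
open import Data.Nat.Properties hiding (_≟_)
open import Algebra.Properties.CommutativeMonoid.Sum +-0-commutativeMonoid
  using (sum-cong-≗; ∑-distrib-+; ∑-comm; sum-replicate-zero) renaming (sum to ∑)
open import Algebra.Properties.Semiring.Sum +-*-semiring using (*-distribˡ-sum; *-distribʳ-sum)
open import Data.Nat.Tactic.RingSolver using (solve-∀)
open import Data.Product using (_,_; proj₁; proj₂; ∃; ∃₂)
open import Data.Rational as ℚ using (mkℚ; toℚᵘ) renaming (_*_ to _*ℚ_; _+_ to _+ℚ_)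
import Data.Rational.Properties as ℚ
open import Data.Rational.Unnormalised as ℚᵘ using (mkℚᵘ; *≡*; *≤*)
import Data.Rational.Unnormalised.Properties as ℚᵘ
open import Data.Sum as Sum using (_⊎_; inj₁; inj₂; [_,_])
open import Data.Vec as Vec using ([]; _∷_; here; there)
open import Data.Vec.Properties using (lookup⇒[]=; []=⇒lookup; lookup∘tabulate)
open import Function using (_∘_; id)
open import Relation.Nullary using (Dec; yes; no; does; ¬_; contradiction)
open import Relation.Nullary.Decidable using (¬?; dec-true; dec-false; decidable-stable)
open import Relation.Binary.PropositionalEquality
  using (refl; sym; trans; cong; cong₂; subst; subst₂; module ≡-Reasoning)

-- Weights of lists.

wt : {A : Set} → (A → ℕ) → List A → ℕ
wt f xs = sum (map f xs)

wt-++ : {A : Set} (f : A → ℕ) (xs ys : List A) → wt f (xs ++ ys) ≡ wt f xs + wt f ys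
wt-++ f xs ys = trans (cong sum (map-++ f xs ys)) (sum-++ (map f xs) (map f ys))

wt-1 : {A : Set} (xs : List A) → wt (λ _ → 1) xs ≡ length xs
wt-1 []       = refl
wt-1 (x ∷ xs) = cong suc (wt-1 xs)

splitAtLength : {A : Set} (k : ℕ) (xs : List A) → k ≤ length xs →
                ∃₂ λ ys zs → ys ++ zs ≡ xs × length ys ≡ k
splitAtLength k xs k≤ = take k xs , drop k xs , take++drop≡id k xs ,
  trans (length-take k xs) (m≤n⇒m⊓n≡m k≤)

-- Routing tokens through a tree of clusters

module Transfer {V : Set} (Near : ℕ → V → V → Set)
  (near-sym : ∀ {a u v} → Near a u v → Near a v u)
  (near-trans : ∀ {a b u v w} → Near a u v → Near b v w → Near (a + b) u w)
  (near-mono : ∀ {a b u v} → a ≤ b → Near a u v → Near b u v)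
  (D : ℕ) where

  Weight : Set
  Weight = V → ℕ

  Parcel : Set
  Parcel = V × List V

  tokW locW : Weight → List Parcel → ℕ
  tokW f = wt (λ p → wt f (proj₂ p))
  locW f = wt (λ p → f (proj₁ p))

  Full : Parcel → Set
  Full (ℓ , ts) = length ts ≡ D × All (λ x → Near 5 x ℓ) ts

  -- Quantifying over all weights f makes tok an equality of multisets of tokens, and loc an inclusion of
  -- multisets of locations: no location is opened that was not available, and none is opened twice.
  record Step (tokIn locIn : Weight → ℕ) (X : Set) (tokOut locOut : Weight → X → ℕ) : Set where
    field
      opened : List Parcel
      full   : All Full opened
      result : X
      tok    : ∀ f → tokW f opened + tokOut f result ≡ tokIn f
      loc    : ∀ f → locW f opened + locOut f result ≤ locIn f
  open Step

  -- A frame rule: `te` and `le` account for tokens and locations that the first step leaves alone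
  -- and that the second may use along with the result of the first.
  andThen : ∀ {ti li X tx lx Y ty ly} (te le : Weight → ℕ) → Step ti li X tx lx →
    ((x : X) → Step (λ f → tx f x + te f) (λ f → lx f x + le f) Y ty ly) →
    Step (λ f → ti f + te f) (λ f → li f + le f) Y ty ly
  andThen {ti} {li} {X} {tx} {lx} {Y} {ty} {ly} te le s k = record
    { opened = opened s ++ opened s'
    ; full   = All.++⁺ (full s) (full s')
    ; result = result s'
    ; tok    = λ f → begin-equality
        tokW f (opened s ++ opened s') + ty f (result s')
          ≡⟨ cong (_+ ty f (result s')) (wt-++ _ (opened s) _) ⟩
        tokW f (opened s) + tokW f (opened s') + ty f (result s')
          ≡⟨ +-assoc (tokW f (opened s)) _ _ ⟩
        tokW f (opened s) + (tokW f (opened s') + ty f (result s'))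
          ≡⟨ cong (tokW f (opened s) +_) (tok s' f) ⟩
        tokW f (opened s) + (tx f (result s) + te f)
          ≡⟨ +-assoc (tokW f (opened s)) _ _ ⟨
        tokW f (opened s) + tx f (result s) + te f
          ≡⟨ cong (_+ te f) (tok s f) ⟩
        ti f + te f ∎
    ; loc    = λ f → begin
        locW f (opened s ++ opened s') + ly f (result s')
          ≡⟨ cong (_+ ly f (result s')) (wt-++ _ (opened s) _) ⟩
        locW f (opened s) + locW f (opened s') + ly f (result s')
          ≡⟨ +-assoc (locW f (opened s)) _ _ ⟩
        locW f (opened s) + (locW f (opened s') + ly f (result s'))
          ≤⟨ +-monoʳ-≤ (locW f (opened s)) (loc s' f) ⟩
        locW f (opened s) + (lx f (result s) + le f)
          ≡⟨ +-assoc (locW f (opened s)) _ _ ⟨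
        locW f (opened s) + lx f (result s) + le f
          ≤⟨ +-monoˡ-≤ (le f) (loc s f) ⟩
        li f + le f ∎
    }
    where
    open ≤-Reasoning
    s' = k (result s)

  -- Tokens have to match exactly, while locations may be wasted: more may be offered on entry and
  -- fewer claimed on exit.
  reindex : ∀ {ti li ti' li' : Weight → ℕ} {X Y tx lx ty ly} (g : X → Y) →
            (∀ f → ti f ≡ ti' f) → (∀ f → li f ≤ li' f) →
            (∀ f x → ty f (g x) ≡ tx f x) → (∀ f x → ly f (g x) ≤ lx f x) →
            Step ti li X tx lx → Step ti' li' Y ty ly
  reindex g ti≡ li≤ ty≡ ly≤ s = record
    { opened = opened s
    ; full   = full s
    ; result = g (result s)
    ; tok    = λ f → trans (cong (tokW f (opened s) +_) (ty≡ f _)) (trans (tok s f) (ti≡ f))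
    ; loc    = λ f → ≤-trans (+-monoʳ-≤ (locW f (opened s)) (ly≤ f _)) (≤-trans (loc s f) (li≤ f))
    }

  record Load (b : ℕ) (c : V) : Set where
    constructor load
    field
      tokens : List V
      near   : All (λ x → Near b x c) tokens
      size   : length tokens ≤ D
  open Load

  loadTok : ∀ {b c} → Weight → Load b c → ℕ
  loadTok f x = wt f (tokens x)

  recenter : ∀ {a b c c'} → Near a c c' → Load b c → Load (b + a) c'
  recenter c~c' (load ts ns s) = load ts (All.map (λ n → near-trans n c~c') ns) s

  keep : ∀ {X tx lx} (x : X) → Step (λ f → tx f x) (λ f → lx f x) X tx lx
  keep x = record { opened = [] ; full = [] ; result = x ; tok = λ _ → refl ; loc = λ _ → ≤-refl }

  -- The location opened is that of the incoming tokens t: the location belonging to h stays in reserve.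
  pour : ∀ {a b c ℓ} → a + b ≤ 5 → Near a ℓ c → (h t : Load b c) →
         Step (λ f → loadTok f h + loadTok f t) (λ f → f ℓ) (Load b c) loadTok (λ _ _ → 0)
  pour {a} {b} {c} {ℓ} a+b≤5 ℓ~c (load h nh sh) (load t nt st) with D ≤? length (h ++ t)
  ... | no small = record
    { opened = [] ; full = []
    ; result = load (h ++ t) (All.++⁺ nh nt) (≰⇒≥ small)
    ; tok = λ f → wt-++ f h t
    ; loc = λ _ → z≤n }
  ... | yes big with splitAtLength D (h ++ t) big
  ... | ys , zs , eq , |ys| = record
    { opened = (ℓ , ys) ∷ []
    ; full   = (|ys| , All.map far (proj₁ parts)) ∷ []
    -- Both loads have at most `D` tokens, so at most `D` remain once `D` are sent off.
    ; result = load zs (proj₂ parts) (+-cancelˡ-≤ D _ _ (begin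
        D + length zs           ≡⟨ cong (_+ length zs) |ys| ⟨
        length ys + length zs   ≡⟨ length-++ ys ⟨
        length (ys ++ zs)       ≡⟨ cong length eq ⟩
        length (h ++ t)         ≡⟨ length-++ h ⟩
        length h + length t     ≤⟨ +-mono-≤ sh st ⟩
        D + D                   ∎))
    ; tok = λ f → begin-equality
        wt f ys + 0 + wt f zs ≡⟨ cong (_+ wt f zs) (+-identityʳ _) ⟩
        wt f ys + wt f zs     ≡⟨ wt-++ f ys zs ⟨
        wt f (ys ++ zs)       ≡⟨ cong (wt f) eq ⟩
        wt f (h ++ t)         ≡⟨ wt-++ f h t ⟩
        wt f h + wt f t       ∎
    ; loc = λ f → ≤-reflexive (trans (+-identityʳ _) (+-identityʳ _)) }
    where
    open ≤-Reasoning
    parts = All.++⁻ ys (subst (All _) (sym eq) (All.++⁺ nh nt))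
    far : ∀ {x} → Near b x c → Near 5 x ℓ
    far n = near-mono (≤-trans (≤-reflexive (+-comm b a)) a+b≤5) (near-trans n (near-sym ℓ~c))

  -- An empty bin has no location in reserve; the first arrival brings one along with its tokens.
  -- Tokens are within `b` of `c` and locations within `a`, so `a + b` bounds the route from one to
  -- the other.
  data Bin (a b : ℕ) (c : V) : Set where
    empty : Bin a b c
    at    : ∀ ℓ → Near a ℓ c → Load b c → Bin a b c

  binTok binLoc : ∀ {a b c} → Weight → Bin a b c → ℕ
  binTok f empty      = 0
  binTok f (at _ _ x) = loadTok f x
  binLoc f empty      = 0
  binLoc f (at ℓ _ _) = f ℓ

  pourBin : ∀ {a b c ℓ} → a + b ≤ 5 → Near a ℓ c → (h : Bin a b c) (t : Load b c) →
            Step (λ f → binTok f h + loadTok f t) (λ f → binLoc f h + f ℓ) (Bin a b c) binTok binLoc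
  pourBin _ ℓ~c empty t = keep (at _ ℓ~c t)
  pourBin a+b≤5 ℓ~c (at ℓ' n h) t =
    record { opened = opened s ; full = full s ; result = at ℓ' n (result s) ; tok = tok s
           ; loc = λ f → ≤-trans (+-monoˡ-≤ (f ℓ') (≤-trans (m≤m+n _ 0) (loc s f))) (≤-reflexive (+-comm _ (f ℓ'))) }
    where s = pour a+b≤5 ℓ~c h t

  -- The location of a member w is spare from the start. The location of a delegate r is taken by the units of
  -- its cluster, so a bucket at r has a spare location only once a parcel has arrived there.
  data Key : Set where
    rep mem : V → Key

  vertex : Key → V
  vertex (rep v) = v
  vertex (mem v) = v

  -- The radii come from the links of the tree: an arriving delegate is within 2 of the key, and
  -- units, within 1 of the centre that they leave, are within 1 + 2 = 3. From there to a location
  -- takes 3 + 2 = 5 edges at most.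
  Bucket : Key → Set
  Bucket (rep r) = Bin 2 3 r
  Bucket (mem w) = Load 3 w

  bucketTok bucketLoc : ∀ {k} → Weight → Bucket k → ℕ
  bucketTok {rep _} f b = binTok f b
  bucketTok {mem _} f b = loadTok f b
  bucketLoc {rep _} f b = binLoc f b
  bucketLoc {mem w} f _ = f w

  bucketsTok bucketsLoc : ∀ {ks} → Weight → All Bucket ks → ℕ
  bucketsTok f []                  = 0
  bucketsTok f (_∷_ {x = k} b bs)  = bucketTok {k} f b + bucketsTok f bs
  bucketsLoc f []                  = 0
  bucketsLoc f (_∷_ {x = k} b bs)  = bucketLoc {k} f b + bucketsLoc f bs

  splitBuckets : ∀ ks {ks'} (bs : All Bucket (ks ++ ks')) →
    ∃₂ λ (bs₁ : All Bucket ks) (bs₂ : All Bucket ks') →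
      (∀ f → bucketsTok f bs ≡ bucketsTok f bs₁ + bucketsTok f bs₂) ×
      (∀ f → bucketsLoc f bs ≡ bucketsLoc f bs₁ + bucketsLoc f bs₂)
  splitBuckets [] bs = [] , bs , (λ _ → refl) , (λ _ → refl)
  splitBuckets (k ∷ ks) (b ∷ bs) with splitBuckets ks bs
  ... | bs₁ , bs₂ , t , l = b ∷ bs₁ , bs₂
    , (λ f → trans (cong (bucketTok {k} f b +_) (t f)) (sym (+-assoc (bucketTok {k} f b) _ _)))
    , (λ f → trans (cong (bucketLoc {k} f b +_) (l f)) (sym (+-assoc (bucketLoc {k} f b) _ _)))

  deliverKey : ∀ {ℓ} k → Near 2 ℓ (vertex k) → (t : Load 3 (vertex k)) (b : Bucket k) →
    Step (λ f → bucketTok {k} f b + loadTok f t) (λ f → bucketLoc {k} f b + f ℓ)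
         (Bucket k) (bucketTok {k}) (bucketLoc {k})
  deliverKey (rep _) ℓ~r t b = pourBin ≤-refl ℓ~r b t
  deliverKey (mem w) ℓ~w t b =
    record { opened = opened s ; full = full s ; result = result s ; tok = tok s
           ; loc = λ f → ≤-trans (+-monoˡ-≤ (f w) (≤-trans (m≤m+n _ 0) (loc s f))) (≤-reflexive (+-comm _ (f w))) }
    where s = pour ≤-refl ℓ~w b t

  deliver : ∀ {ℓ ts ks} → Any (λ k → Near 2 ℓ (vertex k) × All (λ x → Near 3 x (vertex k)) ts) ks →
    length ts ≤ D → (bs : All Bucket ks) →
    Step (λ f → bucketsTok f bs + wt f ts) (λ f → bucketsLoc f bs + f ℓ) (All Bucket ks) bucketsTok bucketsLoc
  deliver {ks = k ∷ _} (here (ℓ~k , ts~k)) s (b ∷ bs) =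
    reindex id (λ f → swap (bucketTok {k} f b) _ _) (λ f → ≤-reflexive (swap (bucketLoc {k} f b) _ _))
      (λ _ _ → refl) (λ _ _ → ≤-refl)
      (andThen (λ f → bucketsTok f bs) (λ f → bucketsLoc f bs)
        (deliverKey k ℓ~k (load _ ts~k s) b) (λ b' → keep (_∷_ {x = k} b' bs)))
    where
    swap : ∀ a b c → a + b + c ≡ a + c + b
    swap = solve-∀
  deliver {ks = k ∷ _} (there i) s (b ∷ bs) =
    reindex (b ∷_) (λ f → rot (bucketTok {k} f b) _ _) (λ f → ≤-reflexive (rot (bucketLoc {k} f b) _ _))
      (λ f bs' → +-comm (bucketTok {k} f b) _) (λ f bs' → ≤-reflexive (+-comm (bucketLoc {k} f b) _))
      (andThen {ty = λ f bs' → bucketsTok f bs' + bucketTok {k} f b} {ly = λ f bs' → bucketsLoc f bs' + bucketLoc {k} f b}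
        (λ f → bucketTok {k} f b) (λ f → bucketLoc {k} f b) (deliver i s bs) keep)
    where
    rot : ∀ a b c → b + c + a ≡ a + b + c
    rot = solve-∀

  -- Dissolving clusters.

  record Cluster : Set where
    field
      centre delegate : V
      members units   : List V
      delegate~ : Near 1 delegate centre
      members~  : All (λ w → Near 1 w centre) members
      units~    : All (λ u → Near 1 u centre) units
      |units|   : length units ≡ D

  keys : Cluster → List Key
  keys c = rep (Cluster.delegate c) ∷ map mem (Cluster.members c)

  -- Seen from the centre, a member is within 1 and the tokens of its bucket within 3 + 1 = 4. One
  -- bin suffices: once the bin and the next bucket together reach `D` tokens, the member just met
  -- is opened and an earlier one stays in reserve.
  gather : ∀ {m} ws → All (λ w → Near 1 w m) ws → (bs : All Bucket (map mem ws)) (h : Bin 1 4 m) →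
    Step (λ f → binTok f h + bucketsTok f bs) (λ f → binLoc f h + bucketsLoc f bs) (Bin 1 4 m) binTok binLoc
  gather [] [] [] h = reindex id (λ f → sym (+-identityʳ _)) (λ f → m≤m+n _ 0) (λ _ _ → refl) (λ _ _ → ≤-refl) (keep h)
  gather (w ∷ ws) (w~m ∷ ws~m) (b ∷ bs) h =
    reindex id (λ f → +-assoc (binTok f h) _ _) (λ f → ≤-reflexive (+-assoc (binLoc f h) _ _))
      (λ _ _ → refl) (λ _ _ → ≤-refl)
      (andThen (λ f → bucketsTok f bs) (λ f → bucketsLoc f bs) (pourBin ≤-refl w~m h (recenter w~m b)) (gather ws ws~m bs))

  -- Units are the flexible tokens: being within 1 of `m`, they can complete a parcel at any
  -- location within 3 of `m`. The length equation serves to bound the units left over.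
  topUp : ∀ {m ℓ} → Near 3 ℓ m → ∀ us → All (λ u → Near 1 u m) us →
    ∀ t → All (λ x → Near 5 x ℓ) t → length t ≤ D → D ≤ length t + length us →
    ∃₂ λ used left → Full (ℓ , t ++ used) × All (λ u → Near 1 u m) left ×
      (length left + D ≡ length t + length us) × used ++ left ≡ us
  topUp {m} {ℓ} ℓ~m us us~ t t~ |t| D≤ with splitAtLength (D ∸ length t) us (m≤n+o⇒m∸n≤o D _ D≤)
  ... | used , left , refl , |used| = used , left
    , (trans (length-++ t) t+used , All.++⁺ t~ (All.map far (proj₁ (All.++⁻ used us~))))
    , proj₂ (All.++⁻ used us~) , lens , refl
    where
    open ≡-Reasoning
    t+used : length t + length used ≡ D
    t+used = trans (cong (length t +_) |used|) (m+[n∸m]≡n |t|)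
    far : ∀ {x} → Near 1 x m → Near 5 x ℓ
    far n = near-mono (n≤1+n 4) (near-trans n (near-sym ℓ~m))
    lens : length left + D ≡ length t + length (used ++ left)
    lens = begin
      length left + D                         ≡⟨ cong (length left +_) t+used ⟨
      length left + (length t + length used)  ≡⟨ +-comm (length left) _ ⟩
      length t + length used + length left    ≡⟨ +-assoc (length t) _ _ ⟩
      length t + (length used + length left)  ≡⟨ cong (length t +_) (length-++ used) ⟨
      length t + length (used ++ left)        ∎

  -- Only units may be passed on. If both bins hold tokens but too few for two locations, those of the delegate's
  -- bin are sent to the spare member; otherwise the units complete one location for each bin.
  finish : ∀ {m r us} → Near 1 r m → All (λ u → Near 1 u m) us → length us ≡ D →
    (h : Bin 1 4 m) (g : Bin 2 3 r) →
    Step (λ f → binTok f h + binTok f g + wt f us) (λ f → binLoc f h + binLoc f g)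
         (Load 1 m) loadTok (λ _ _ → 0)
  finish r~m us~ |us| empty empty = keep (load _ us~ (≤-reflexive |us|))
  finish {us = us} r~m us~ |us| (at ℓ ℓ~m h) empty with topUp (near-mono (s≤s z≤n) ℓ~m) us us~ (tokens h)
    (All.map (λ n → near-trans n (near-sym ℓ~m)) (near h)) (size h)
    (≤-trans (≤-reflexive (sym |us|)) (m≤n+m _ _))
  ... | used , left , full₁ , left~ , |left| , refl = record
    { opened = (ℓ , tokens h ++ used) ∷ []
    ; full   = full₁ ∷ []
    ; result = load left left~ (+-cancelʳ-≤ D _ _ (≤-trans (≤-reflexive |left|) (+-mono-≤ (size h) (≤-reflexive |us|))))
    ; tok    = λ f → trans (cong (λ z → z + 0 + wt f left) (wt-++ f (tokens h) used))
                 (trans (regroup (loadTok f h) _ _) (cong (loadTok f h + 0 +_) (sym (wt-++ f used left))))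
    ; loc    = λ f → ≤-reflexive (+-identityʳ _) }
    where
    regroup : ∀ a b c → a + b + 0 + c ≡ a + 0 + (b + c)
    regroup = solve-∀
  finish {us = us} r~m us~ |us| empty (at ℓ ℓ~r g) with topUp (near-trans ℓ~r r~m) us us~ (tokens g)
    (All.map (λ n → near-trans n (near-sym ℓ~r)) (near g)) (size g)
    (≤-trans (≤-reflexive (sym |us|)) (m≤n+m _ _))
  ... | used , left , full₁ , left~ , |left| , refl = record
    { opened = (ℓ , tokens g ++ used) ∷ []
    ; full   = full₁ ∷ []
    ; result = load left left~ (+-cancelʳ-≤ D _ _ (≤-trans (≤-reflexive |left|) (+-mono-≤ (size g) (≤-reflexive |us|))))
    ; tok    = λ f → trans (cong (λ z → z + 0 + wt f left) (wt-++ f (tokens g) used))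
                 (trans (regroup (loadTok f g) _ _) (cong (loadTok f g +_) (sym (wt-++ f used left))))
    ; loc    = λ f → ≤-reflexive (trans (+-identityʳ _) (+-identityʳ _)) }
    where
    regroup : ∀ a b c → a + b + 0 + c ≡ a + (b + c)
    regroup = solve-∀
  finish {us = us} r~m us~ |us| (at ℓ ℓ~m h) (at ℓ' ℓ'~r g) with length (tokens h ++ tokens g) ≤? D
  -- The tokens of `g` take 3 + 1 + 1 edges through `r` and `m` to `ℓ`; the location `ℓ'` stays
  -- closed.
  ... | yes small with topUp (near-mono (s≤s z≤n) ℓ~m) us us~ (tokens h ++ tokens g)
    (All.++⁺ (All.map (λ n → near-trans n (near-sym ℓ~m)) (near h))
             (All.map (λ n → near-trans n (near-trans r~m (near-sym ℓ~m))) (near g)))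
    small (≤-trans (≤-reflexive (sym |us|)) (m≤n+m _ _))
  ... | used , left , full₁ , left~ , |left| , refl = record
    { opened = (ℓ , (tokens h ++ tokens g) ++ used) ∷ []
    ; full   = full₁ ∷ []
    ; result = load left left~ (+-cancelʳ-≤ D _ _ (≤-trans (≤-reflexive |left|) (+-mono-≤ small (≤-reflexive |us|))))
    ; tok    = λ f → trans (cong (λ z → z + 0 + wt f left)
                   (trans (wt-++ f (tokens h ++ tokens g) used) (cong (_+ wt f used) (wt-++ f (tokens h) (tokens g)))))
                 (trans (regroup (loadTok f h) _ _ _) (cong (loadTok f h + loadTok f g +_) (sym (wt-++ f used left))))
    ; loc    = λ f → ≤-trans (≤-reflexive (trans (+-identityʳ _) (+-identityʳ _))) (m≤m+n _ _) }
    where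
    regroup : ∀ a b c d → a + b + c + 0 + d ≡ a + b + (c + d)
    regroup = solve-∀
  finish {us = us} r~m us~ |us| (at ℓ ℓ~m h) (at ℓ' ℓ'~r g) | no large
    with topUp (near-mono (s≤s z≤n) ℓ~m) us us~ (tokens h)
      (All.map (λ n → near-trans n (near-sym ℓ~m)) (near h)) (size h)
      (≤-trans (≤-reflexive (sym |us|)) (m≤n+m _ _))
  ... | used , left , full₁ , left~ , |left| , refl
    with topUp (near-trans ℓ'~r r~m) left left~ (tokens g)
      (All.map (λ n → near-trans n (near-sym ℓ'~r)) (near g)) (size g) enough
    where
    -- The units started out as `D` in number, so after completing the first parcel as many are left
    -- as `h` has tokens. Since `h` and `g` hold at least `D` together, these complete the second.
    |left|≡|h| : length left ≡ length (tokens h)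
    |left|≡|h| = +-cancelʳ-≡ D _ _ (trans |left| (cong (length (tokens h) +_) |us|))
    enough : D ≤ length (tokens g) + length left
    enough = ≤-trans (≰⇒≥ large) (≤-reflexive (trans (length-++ (tokens h))
      (trans (+-comm (length (tokens h)) _) (cong (length (tokens g) +_) (sym |left|≡|h|)))))
  ... | used' , left' , full₂ , left'~ , |left'| , refl = record
    { opened = (ℓ , tokens h ++ used) ∷ (ℓ' , tokens g ++ used') ∷ []
    ; full   = full₁ ∷ full₂ ∷ []
    ; result = load left' left'~ (+-cancelʳ-≤ D _ _ (≤-trans (≤-reflexive |left'|)
                 (≤-trans (+-mono-≤ (size g) (≤-reflexive |left|≡|h|)) (+-monoʳ-≤ D (size h)))))
    ; tok    = λ f → trans (cong₂ (λ y z → y + (z + 0) + wt f left') (wt-++ f (tokens h) used) (wt-++ f (tokens g) used'))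
                 (trans (regroup (loadTok f h) _ (loadTok f g) _ _) (cong (loadTok f h + loadTok f g +_)
                   (sym (trans (wt-++ f used _) (cong (wt f used +_) (wt-++ f used' left'))))))
    ; loc    = λ f → ≤-reflexive (trans (+-identityʳ _) (cong (f ℓ +_) (+-identityʳ _))) }
    where
    |left|≡|h| : length (used' ++ left') ≡ length (tokens h)
    |left|≡|h| = +-cancelʳ-≡ D _ _ (trans |left| (cong (length (tokens h) +_) |us|))
    regroup : ∀ a b c d e → a + b + (c + d + 0) + e ≡ a + c + (b + (d + e))
    regroup = solve-∀

  -- The radius of the result is 1 because `finish` lets only units out. Tokens received from newer
  -- clusters are settled here, so distances do not accumulate with the depth of the tree.
  stage : (c : Cluster) → let open Cluster c in (bs : All Bucket (keys c)) →
    Step (λ f → bucketsTok f bs + wt f units) (λ f → bucketsLoc f bs) (Load 1 centre) loadTok (λ _ _ → 0)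
  stage c (g ∷ bs) =
    reindex id (λ f → regroup (binTok f g) _ _) (λ f → ≤-reflexive (+-comm _ (binLoc f g)))
      (λ _ _ → refl) (λ _ _ → ≤-refl)
      (andThen (λ f → binTok f g + wt f units) (λ f → binLoc f g)
        (gather members members~ bs empty)
        (λ h → reindex id (λ f → +-assoc (binTok f h) _ _) (λ _ → ≤-refl) (λ _ _ → refl) (λ _ _ → ≤-refl)
                 (finish delegate~ units~ |units| h g)))
    where
    open Cluster c
    regroup : ∀ a b c → b + (a + c) ≡ a + b + c
    regroup = solve-∀

  -- The newest cluster is outermost, so that a cluster is dissolved before the one it hangs from.
  data Tree : List Key → Set where
    root : (c : Cluster) → Tree (keys c)
    grow : ∀ {ks} (c : Cluster) → let open Cluster c in
           Any (λ k → Near 2 centre (vertex k) × Near 2 delegate (vertex k)) ks →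
           Tree ks → Tree (keys c ++ ks)

  unitTok delegateLoc : ∀ {ks} → Weight → Tree ks → ℕ
  unitTok f (root c)         = wt f (Cluster.units c)
  unitTok f (grow c _ T)     = wt f (Cluster.units c) + unitTok f T
  delegateLoc f (root c)     = f (Cluster.delegate c)
  delegateLoc f (grow c _ T) = f (Cluster.delegate c) + delegateLoc f T

  solve : ∀ {ks} (T : Tree ks) (bs : All Bucket ks) →
    Step (λ f → bucketsTok f bs + unitTok f T) (λ f → bucketsLoc f bs + delegateLoc f T)
         (Σ V (Load 5)) (λ f x → loadTok f (proj₂ x)) (λ f x → f (proj₁ x))
  solve (root c) bs =
    -- The root has no older cluster to pass its units to. They are returned with the delegate as
    -- their location, at distance at most 1 + 1, and may fall short of `D`.
    reindex (λ x → delegate , load (tokens x)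
                (All.map (λ n → near-mono (s≤s (s≤s z≤n)) (near-trans n (near-sym delegate~))) (near x)) (size x))
      (λ _ → +-identityʳ _) (λ _ → ≤-refl) (λ _ _ → refl) (λ _ _ → ≤-refl)
      (andThen {tx = loadTok} {lx = λ _ _ → 0} {ty = loadTok} {ly = λ f _ → f delegate} (λ _ → 0) (λ f → f delegate)
        (stage c bs)
        (λ x → reindex id (λ _ → sym (+-identityʳ _)) (λ _ → ≤-refl) (λ _ _ → refl) (λ _ _ → ≤-refl) (keep x)))
    where open Cluster c
  solve (grow {ks} c link T) bs with splitBuckets (keys c) bs
  ... | bs₁ , bs₂ , tok≡ , loc≡ =
    reindex id
      (λ f → trans (regroup (bucketsTok f bs₁) _ _ _) (cong (_+ _) (sym (tok≡ f))))
      (λ f → ≤-reflexive (trans (sym (+-assoc (bucketsLoc f bs₁) _ _)) (cong (_+ (f delegate + delegateLoc f T)) (sym (loc≡ f)))))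
      (λ _ _ → refl) (λ _ _ → ≤-refl)
      (andThen (λ f → bucketsTok f bs₂ + unitTok f T) (λ f → bucketsLoc f bs₂ + (f delegate + delegateLoc f T))
        (stage c bs₁)
        (λ x → reindex id
           (λ f → swap (bucketsTok f bs₂) _ _) (λ f → ≤-reflexive (+-assoc (bucketsLoc f bs₂) _ _))
           (λ _ _ → refl) (λ _ _ → ≤-refl)
           (andThen (λ f → unitTok f T) (λ f → delegateLoc f T)
             (deliver (Any.map (λ {k} (c~k , r~k) → r~k , All.map (λ n → near-trans n c~k) (near x)) link) (size x) bs₂)
             (solve T))))
    where
    open Cluster c
    regroup : ∀ a b c d → a + b + (c + d) ≡ a + c + (b + d)
    regroup = solve-∀
    swap : ∀ a b c → a + b + c ≡ b + (a + c)
    swap = solve-∀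

-- Finite sums and Hall's theorem

χ : {P : Set} → Dec P → ℕ
χ P? = if does P? then 1 else 0

χ≡1 : {P : Set} (P? : Dec P) → P → χ P? ≡ 1
χ≡1 P? p = cong (if_then 1 else 0) (dec-true P? p)

χ≡0 : {P : Set} (P? : Dec P) → ¬ P → χ P? ≡ 0
χ≡0 P? ¬p = cong (if_then 1 else 0) (dec-false P? ¬p)

χ≤ : {P : Set} (P? : Dec P) {x : ℕ} → (P → 1 ≤ x) → χ P? ≤ x
χ≤ (yes p) 1≤x = 1≤x p
χ≤ (no ¬p) _   = z≤n

χ-mono : {P Q : Set} (P? : Dec P) (Q? : Dec Q) → (P → Q) → χ P? ≤ χ Q?
χ-mono P? Q? f = χ≤ P? (λ p → ≤-reflexive (sym (χ≡1 Q? (f p))))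

χ*≤ : {P : Set} (P? : Dec P) {x y : ℕ} → (P → x ≤ y) → χ P? * x ≤ y
χ*≤ (yes p) x≤y = ≤-trans (≤-reflexive (*-identityˡ _)) (x≤y p)
χ*≤ (no _)  _   = z≤n

χ* : {P : Set} (P? : Dec P) (x : ℕ) → P → χ P? * x ≡ x
χ* P? x p = trans (cong (_* x) (χ≡1 P? p)) (*-identityˡ x)

∑-mono : ∀ {n} {f g : Fin n → ℕ} → (∀ i → f i ≤ g i) → ∑ f ≤ ∑ g
∑-mono {zero}  f≤g = z≤n
∑-mono {suc n} f≤g = +-mono-≤ (f≤g zero) (∑-mono (λ i → f≤g (suc i)))

∑≤0 : ∀ {n} {f : Fin n → ℕ} → (∀ i → f i ≤ 0) → ∑ f ≤ 0
∑≤0 {n} f≤0 = ≤-trans (∑-mono {g = λ _ → 0} f≤0) (≤-reflexive (sum-replicate-zero n))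

∑-δ : ∀ {n} (j : Fin n) (f : Fin n → ℕ) → ∑ (λ i → χ (i ≟ j) * f i) ≡ f j
∑-δ {suc n} zero    f = trans (cong₂ _+_ (+-identityʳ (f zero)) (sum-replicate-zero n)) (+-identityʳ _)
∑-δ {suc n} (suc j) f = ∑-δ j (f ∘ suc)

term≤∑ : ∀ {n} (f : Fin n → ℕ) j → f j ≤ ∑ f
term≤∑ f j = ≤-trans (≤-reflexive (sym (∑-δ j f))) (∑-mono (λ i → χ*≤ (i ≟ j) (λ _ → ≤-refl)))

∑>0⇒∃ : ∀ {n} (f : Fin n → ℕ) → 1 ≤ ∑ f → ∃ λ i → 1 ≤ f i
∑>0⇒∃ {suc n} f 1≤ with f zero in eq
... | suc _ = zero , ≤-trans (s≤s z≤n) (≤-reflexive (sym eq))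
... | zero  with ∑>0⇒∃ (f ∘ suc) 1≤
... | i , p = suc i , p

-- Cardinality as a sum of indicators, so that it can be compared termwise with other sums;
-- `size≡∣∣` identifies it with `∣_∣`.
size : ∀ {n} → Subset n → ℕ
size A = ∑ (λ a → χ (a ∈? A))

∈─⇒∉ : ∀ {n} {A B : Subset n} {a} → a ∈ A ─ B → a ∉ B
∈─⇒∉ {A = inside ∷ _}  {inside ∷ _}  ()         here
∈─⇒∉ {A = outside ∷ _} {inside ∷ _}  ()         here
∈─⇒∉ {A = _ ∷ _}       {inside ∷ _}  (there a∈) (there a∈B) = ∈─⇒∉ a∈ a∈B
∈─⇒∉ {A = _ ∷ _}       {outside ∷ _} (there a∈) (there a∈B) = ∈─⇒∉ a∈ a∈B

-- Hall's theorem with capacities.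

module Hall {n m : ℕ} (R : Fin n → Fin m → Set) (R? : ∀ a b → Dec (R a b)) (default : Fin n → Fin m) where

  Hit : Subset n → Fin m → Set
  Hit B b = ∃ λ a → a ∈ B × R a b

  hit? : ∀ B b → Dec (Hit B b)
  hit? B b = any? (λ a → (a ∈? B) ×-dec R? a b)

  supply : (Fin m → ℕ) → Subset n → ℕ
  supply cap B = ∑ (λ b → χ (hit? B b) * cap b)

  HallCondition : Subset n → (Fin m → ℕ) → Set
  HallCondition A cap = ∀ B → B ⊆ A → size B ≤ supply cap B

  load : Subset n → (Fin n → Fin m) → Fin m → ℕ
  load A σ b = ∑ (λ a → χ ((a ∈? A) ×-dec (σ a ≟ b)))

  Matching : Subset n → (Fin m → ℕ) → Set
  Matching A cap = ∃ λ σ → (∀ a → a ∈ A → R a (σ a)) × (∀ b → load A σ b ≤ cap b)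

  -- Halmos–Vaughan: either a proper subset of A is tight and can be matched separately, or any first choice for
  -- some a₀ ∈ A preserves the condition.
  hall : ∀ k A cap → size A ≤ k → HallCondition A cap → Matching A cap
  hall k A cap |A|≤k cond with nonempty? A
  -- On an empty `A` nothing is asked of the assignment; `default` makes it a total function.
  ... | no A∅ = default , (λ a a∈A → ⊥-elim (A∅ (a , a∈A)))
    , λ b → ≤-trans (∑≤0 (λ a → χ≤ ((a ∈? A) ×-dec (default a ≟ b)) (λ (a∈A , _) → ⊥-elim (A∅ (a , a∈A))))) z≤n
  hall zero A cap |A|≤k cond | yes (a₀ , a₀∈A) =
    contradiction (≤-trans (≤-reflexive (sym (χ≡1 (a₀ ∈? A) a₀∈A))) (≤-trans (term≤∑ (λ a → χ (a ∈? A)) a₀) |A|≤k)) λ ()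
  hall (suc k) A cap |A|≤k cond | yes (a₀ , a₀∈A)
    with anySubset? (λ B → (B ⊆? A) ×-dec nonempty? B ×-dec (size B <? size A) ×-dec (supply cap B ≤? size B))
  ... | yes (B , B⊆A , (b₀ , b₀∈B) , |B|<|A| , tight) = σ , matched , loads
    where
    C = A ─ B

    -- A tight `B` may use up all capacity among its neighbours, so none of it is offered to `C`.
    cap' : Fin m → ℕ
    cap' b = χ (¬? (hit? B b)) * cap b

    inB = hall k B cap (≤-pred (≤-trans |B|<|A| |A|≤k)) (λ E E⊆B → cond E (B⊆A ∘ E⊆B))

    |B|≥1 : 1 ≤ size B
    |B|≥1 = ≤-trans (≤-reflexive (sym (χ≡1 (b₀ ∈? B) b₀∈B))) (term≤∑ (λ a → χ (a ∈? B)) b₀)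

    disjoint : ∀ E D → (∀ {a} → a ∈ E → a ∉ D) → ∀ F → E ⊆ F → D ⊆ F → size E + size D ≤ size F
    disjoint E D E∩D F E⊆F D⊆F = ≤-trans (≤-reflexive (sym (∑-distrib-+ {n} _ _))) (∑-mono pointwise)
      where
      pointwise : ∀ a → χ (a ∈? E) + χ (a ∈? D) ≤ χ (a ∈? F)
      pointwise a with a ∈? E
      ... | no _    = χ-mono (a ∈? D) (a ∈? F) D⊆F
      ... | yes a∈E = ≤-reflexive (trans (cong suc (χ≡0 (a ∈? D) (E∩D a∈E))) (sym (χ≡1 (a ∈? F) (E⊆F a∈E))))

    supply-∪ : ∀ E → supply cap (E ∪ B) ≤ supply cap' E + supply cap B
    supply-∪ E = ≤-trans (∑-mono pointwise) (≤-reflexive (∑-distrib-+ {m} _ _))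
      where
      pointwise : ∀ b → χ (hit? (E ∪ B) b) * cap b ≤ χ (hit? E b) * cap' b + χ (hit? B b) * cap b
      pointwise b = χ*≤ (hit? (E ∪ B) b) cover
        where
        cover : Hit (E ∪ B) b → cap b ≤ χ (hit? E b) * cap' b + χ (hit? B b) * cap b
        cover (a , a∈ , Rab) with hit? B b
        ... | yes _  = ≤-trans (m≤m+n (cap b) 0) (m≤n+m _ (χ (hit? E b) * 0))
        ... | no ¬hB with x∈p∪q⁻ E B a∈
        ... | inj₂ a∈B = ⊥-elim (¬hB (a , a∈B , Rab))
        ... | inj₁ a∈E = ≤-reflexive (sym (trans (+-identityʳ _) (trans (χ* (hit? E b) _ (a , a∈E , Rab)) (+-identityʳ _))))

    -- The condition for `E` inside `C` follows from that for `E ∪ B` by cancelling the tight `B`.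
    inC = hall k C cap'
      (≤-pred (≤-trans (+-mono-≤ |B|≥1 ≤-refl)
        (≤-trans (≤-reflexive (+-comm (size B) _))
          (≤-trans (disjoint C B ∈─⇒∉ A (p─q⊆p A B) B⊆A) |A|≤k))))
      (λ E E⊆C → +-cancelʳ-≤ (size B) _ _ (begin
        size E + size B               ≤⟨ disjoint E B (∈─⇒∉ ∘ E⊆C) (E ∪ B) (p⊆p∪q B) (q⊆p∪q E B) ⟩
        size (E ∪ B)                  ≤⟨ cond (E ∪ B) ([ p─q⊆p A B ∘ E⊆C , B⊆A ] ∘ x∈p∪q⁻ E B) ⟩
        supply cap (E ∪ B)            ≤⟨ supply-∪ E ⟩
        supply cap' E + supply cap B  ≤⟨ +-monoʳ-≤ (supply cap' E) tight ⟩
        supply cap' E + size B        ∎))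
      where open ≤-Reasoning

    σ : Fin n → Fin m
    σ a = if does (a ∈? B) then proj₁ inB a else proj₁ inC a

    matched : ∀ a → a ∈ A → R a (σ a)
    matched a a∈A with a ∈? B
    ... | yes a∈B = proj₁ (proj₂ inB) a a∈B
    ... | no a∉B  = proj₁ (proj₂ inC) a (x∈p∧x∉q⇒x∈p─q a∈A a∉B)

    loads : ∀ b → load A σ b ≤ cap b
    loads b = begin
      load A σ b                                        ≤⟨ ∑-mono pointwise ⟩
      ∑ {n} _                                           ≡⟨ ∑-distrib-+ {n} _ _ ⟩
      load B (proj₁ inB) b + load C (proj₁ inC) b       ≤⟨ +-monoʳ-≤ _ (proj₂ (proj₂ inC) b) ⟩
      load B (proj₁ inB) b + χ (¬? (hit? B b)) * cap b  ≤⟨ split ⟩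
      cap b                                             ∎
      where
      open ≤-Reasoning
      pointwise : ∀ a → χ ((a ∈? A) ×-dec (σ a ≟ b)) ≤
        χ ((a ∈? B) ×-dec (proj₁ inB a ≟ b)) + χ ((a ∈? C) ×-dec (proj₁ inC a ≟ b))
      pointwise a = χ≤ ((a ∈? A) ×-dec (σ a ≟ b)) cases
        where
        cases : a ∈ A × σ a ≡ b → 1 ≤ χ ((a ∈? B) ×-dec (proj₁ inB a ≟ b)) + χ ((a ∈? C) ×-dec (proj₁ inC a ≟ b))
        cases (a∈A , σa≡b) with a ∈? B
        ... | yes a∈B = ≤-trans (≤-reflexive (sym (χ≡1 (proj₁ inB a ≟ b) σa≡b))) (m≤m+n _ _)
        ... | no a∉B  = ≤-reflexive (sym (χ≡1 ((a ∈? C) ×-dec (proj₁ inC a ≟ b)) (x∈p∧x∉q⇒x∈p─q a∈A a∉B , σa≡b)))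
      -- A vertex hit by `B` has no capacity left for `C`, and any other vertex has no load from
      -- `B`.
      split : load B (proj₁ inB) b + χ (¬? (hit? B b)) * cap b ≤ cap b
      split with hit? B b
      ... | yes _  = ≤-trans (≤-reflexive (+-identityʳ _)) (proj₂ (proj₂ inB) b)
      ... | no ¬hB = +-mono-≤
          (∑≤0 (λ a → χ≤ ((a ∈? B) ×-dec (proj₁ inB a ≟ b))
             (λ (a∈B , eq) → ⊥-elim (¬hB (a , a∈B , subst (R a) eq (proj₁ (proj₂ inB) a a∈B))))))
          (≤-reflexive (+-identityʳ _))

  ... | no ¬tight = σ , matched , loads
    where
    single : size ⁅ a₀ ⁆ ≤ supply cap ⁅ a₀ ⁆
    single = cond ⁅ a₀ ⁆ (λ x∈ → subst (_∈ A) (sym (x∈⁅y⁆⇒x≡y a₀ x∈)) a₀∈A)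

    choice : ∃ λ b → R a₀ b × 1 ≤ cap b
    choice with ∑>0⇒∃ (λ b → χ (hit? ⁅ a₀ ⁆ b) * cap b)
      (≤-trans (≤-reflexive (sym (χ≡1 (a₀ ∈? ⁅ a₀ ⁆) (x∈⁅x⁆ a₀)))) (≤-trans (term≤∑ (λ a → χ (a ∈? ⁅ a₀ ⁆)) a₀) single))
    ... | b , p with hit? ⁅ a₀ ⁆ b
    ... | yes (a , a∈ , Rab) = b , subst (λ z → R z b) (x∈⁅y⁆⇒x≡y a₀ a∈) Rab , ≤-trans p (≤-reflexive (+-identityʳ _))

    b₁ = proj₁ choice

    A' = A - a₀

    cap' : Fin m → ℕ
    cap' b = cap b ∸ χ (b ≟ b₁)

    A'⊆A : A' ⊆ A
    A'⊆A = p─q⊆p A ⁅ a₀ ⁆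

    smaller : ∀ E → E ⊆ A' → size E < size A
    smaller E E⊆A' = begin
      suc (size E)                              ≡⟨ +-comm 1 _ ⟩
      size E + 1                                ≡⟨ cong (size E +_) (∑-δ a₀ (λ _ → 1)) ⟨
      size E + ∑ (λ a → χ (a ≟ a₀) * 1)         ≡⟨ ∑-distrib-+ {n} _ _ ⟨
      ∑ (λ a → χ (a ∈? E) + χ (a ≟ a₀) * 1)     ≤⟨ ∑-mono pointwise ⟩
      size A                                    ∎
      where
      open ≤-Reasoning
      pointwise : ∀ a → χ (a ∈? E) + χ (a ≟ a₀) * 1 ≤ χ (a ∈? A)
      pointwise a with a ≟ a₀
      ... | no _     = ≤-trans (≤-reflexive (+-identityʳ _)) (χ-mono (a ∈? E) (a ∈? A) (A'⊆A ∘ E⊆A'))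
      ... | yes refl = ≤-reflexive (trans (cong (_+ 1) (χ≡0 (a ∈? E) (λ a∈E → ∈─⇒∉ (E⊆A' a∈E) (x∈⁅x⁆ a))))
                                          (sym (χ≡1 (a ∈? A) a₀∈A)))

    supply-cap' : ∀ E → supply cap E ≤ supply cap' E + 1
    supply-cap' E = begin
      supply cap E                                                 ≤⟨ ∑-mono pointwise ⟩
      ∑ (λ b → χ (hit? E b) * cap' b + χ (b ≟ b₁) * 1)             ≡⟨ ∑-distrib-+ {m} _ _ ⟩
      supply cap' E + ∑ (λ b → χ (b ≟ b₁) * 1)                     ≡⟨ cong (supply cap' E +_) (∑-δ b₁ (λ _ → 1)) ⟩
      supply cap' E + 1                                            ∎
      where
      open ≤-Reasoning
      pointwise : ∀ b → χ (hit? E b) * cap b ≤ χ (hit? E b) * cap' b + χ (b ≟ b₁) * 1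
      pointwise b with hit? E b
      ... | no _  = z≤n
      ... | yes _ = ≤-trans (≤-reflexive (+-identityʳ _)) (≤-trans (m≤n+m∸n (cap b) (χ (b ≟ b₁)))
        (≤-reflexive (trans (+-comm (χ (b ≟ b₁)) _) (cong₂ _+_ (sym (+-identityʳ (cap' b))) (sym (*-identityʳ _))))))

    -- A non-empty subset of `A'` is smaller than `A`, hence not tight: its supply exceeds its size,
    -- which pays for the unit of capacity taken from `b₁`.
    cond' : HallCondition A' cap'
    cond' E E⊆A' with nonempty? E
    ... | no E∅ = ≤-trans (∑≤0 (λ a → χ≤ (a ∈? E) (λ a∈E → ⊥-elim (E∅ (a , a∈E))))) z≤n
    ... | yes E≠∅ = ≤-pred (≤-trans
      (≰⇒> (λ t → ¬tight (E , A'⊆A ∘ E⊆A' , E≠∅ , smaller E E⊆A' , t)))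
      (≤-trans (supply-cap' E) (≤-reflexive (+-comm _ 1))))

    rest = hall k A' cap' (≤-pred (≤-trans (smaller A' id) |A|≤k)) cond'

    σ : Fin n → Fin m
    σ a = if does (a ≟ a₀) then b₁ else proj₁ rest a

    matched : ∀ a → a ∈ A → R a (σ a)
    matched a a∈A with a ≟ a₀
    ... | yes refl = proj₁ (proj₂ choice)
    ... | no a≢a₀  = proj₁ (proj₂ rest) a (x∈p∧x≢y⇒x∈p-y a∈A a≢a₀)

    loads : ∀ b → load A σ b ≤ cap b
    loads b = begin
      load A σ b                          ≤⟨ ∑-mono pointwise ⟩
      ∑ {n} _                             ≡⟨ ∑-distrib-+ {n} _ _ ⟩
      load A' (proj₁ rest) b + ∑ (λ a → χ (a ≟ a₀) * χ (b ≟ b₁))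
                                          ≡⟨ cong (load A' (proj₁ rest) b +_) (∑-δ a₀ (λ _ → χ (b ≟ b₁))) ⟩
      load A' (proj₁ rest) b + χ (b ≟ b₁) ≤⟨ +-monoˡ-≤ _ (proj₂ (proj₂ rest) b) ⟩
      cap b ∸ χ (b ≟ b₁) + χ (b ≟ b₁)     ≡⟨ m∸n+n≡m (χ≤ (b ≟ b₁) (λ { refl → proj₂ (proj₂ choice) })) ⟩
      cap b                               ∎
      where
      open ≤-Reasoning
      pointwise : ∀ a → χ ((a ∈? A) ×-dec (σ a ≟ b)) ≤
        χ ((a ∈? A') ×-dec (proj₁ rest a ≟ b)) + χ (a ≟ a₀) * χ (b ≟ b₁)
      pointwise a = χ≤ ((a ∈? A) ×-dec (σ a ≟ b)) cases
        where
        cases : a ∈ A × σ a ≡ b → 1 ≤ χ ((a ∈? A') ×-dec (proj₁ rest a ≟ b)) + χ (a ≟ a₀) * χ (b ≟ b₁)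
        cases (a∈A , σa≡b) with a ≟ a₀
        ... | yes refl = ≤-trans (≤-reflexive (sym (trans (+-identityʳ _) (χ≡1 (b ≟ b₁) (sym σa≡b)))))
                                 (m≤n+m _ (χ ((a ∈? A') ×-dec (proj₁ rest a ≟ b))))
        ... | no a≢a₀  = ≤-trans (≤-reflexive (sym (χ≡1 ((a ∈? A') ×-dec (proj₁ rest a ≟ b))
                                 (x∈p∧x≢y⇒x∈p-y a∈A a≢a₀ , σa≡b)))) (m≤m+n _ 0)

-- Clearing denominators

-- `ℕtoℚ` divides out a gcd and computes only once `k` is known to be coprime to 1. The arithmetic
-- below therefore passes to unnormalised fractions.
toℚᵘ-ℕtoℚ : ∀ k → toℚᵘ (ℕtoℚ k) ≡ mkℚᵘ (ℤ.+ k) 0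
toℚᵘ-ℕtoℚ k = cong toℚᵘ (ℚ.normalize-coprime {k} {0} (Coprime.sym (1-coprimeTo k)))

ℕtoℚ-+ : ∀ a b → ℕtoℚ a +ℚ ℕtoℚ b ≡ ℕtoℚ (a + b)
ℕtoℚ-+ a b = ℚ.toℚᵘ-injective (ℚᵘ.≃-trans (ℚ.toℚᵘ-homo-+ (ℕtoℚ a) (ℕtoℚ b))
  (subst₂ ℚᵘ._≃_ (sym (cong₂ ℚᵘ._+_ (toℚᵘ-ℕtoℚ a) (toℚᵘ-ℕtoℚ b))) (sym (toℚᵘ-ℕtoℚ (a + b)))
    (*≡* (cong (ℤ._* ℤ.1ℤ) (cong₂ ℤ._+_ (ℤ.*-identityʳ (ℤ.+ a)) (ℤ.*-identityʳ (ℤ.+ b)))))))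

ℕtoℚ-* : ∀ a b → ℕtoℚ a *ℚ ℕtoℚ b ≡ ℕtoℚ (a * b)
ℕtoℚ-* a b = ℚ.toℚᵘ-injective (ℚᵘ.≃-trans (ℚ.toℚᵘ-homo-* (ℕtoℚ a) (ℕtoℚ b))
  (subst₂ ℚᵘ._≃_ (sym (cong₂ ℚᵘ._*_ (toℚᵘ-ℕtoℚ a) (toℚᵘ-ℕtoℚ b))) (sym (toℚᵘ-ℕtoℚ (a * b)))
    (*≡* (cong (ℤ._* ℤ.1ℤ) (sym (ℤ.pos-* a b))))))

ℕtoℚ-cancel-≤ : ∀ {a b} → ℕtoℚ a ≤ℚ ℕtoℚ b → a ≤ b
ℕtoℚ-cancel-≤ {a} {b} a≤b with subst₂ ℚᵘ._≤_ (toℚᵘ-ℕtoℚ a) (toℚᵘ-ℕtoℚ b) (ℚ.toℚᵘ-mono-≤ a≤b)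
... | *≤* p = ℤ.drop‿+≤+ (subst₂ ℤ._≤_ (ℤ.*-identityʳ _) (ℤ.*-identityʳ _) p)

ℕtoℚ-injective : ∀ {a b} → ℕtoℚ a ≡ ℕtoℚ b → a ≡ b
ℕtoℚ-injective eq = ≤-antisym (ℕtoℚ-cancel-≤ (ℚ.≤-reflexive eq)) (ℕtoℚ-cancel-≤ (ℚ.≤-reflexive (sym eq)))

*ℕtoℚ-mono-≤ : ∀ D {p q} → p ≤ℚ q → p *ℚ ℕtoℚ D ≤ℚ q *ℚ ℕtoℚ D
*ℕtoℚ-mono-≤ D = ℚ.*-monoʳ-≤-nonNeg (ℕtoℚ D) {{nonNeg}}
  where
  nonNeg : ℚ.NonNegative (ℕtoℚ D)
  nonNeg = subst ℚ.NonNegative (sym (ℚ.normalize-coprime {D} {0} (Coprime.sym (1-coprimeTo D)))) _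

-- The sign condition guards only the equation, so that `N` can be given for every `q`: the
-- variables outside `S` are unconstrained and may be negative.
Clears : ℕ → ℚ → Set
Clears D q = ∃ λ N → 0ℚ ≤ℚ q → q *ℚ ℕtoℚ D ≡ ℕtoℚ N

clears-denominator : ∀ q → ∃ λ d → 0 < d × Clears d q
clears-denominator q@(mkℚ (ℤ.+ a) d-1 _) = suc d-1 , s≤s z≤n , a , λ _ →
  ℚ.toℚᵘ-injective (ℚᵘ.≃-trans (ℚ.toℚᵘ-homo-* q (ℕtoℚ (suc d-1)))
    (subst₂ ℚᵘ._≃_ (sym (cong (toℚᵘ q ℚᵘ.*_) (toℚᵘ-ℕtoℚ (suc d-1)))) (sym (toℚᵘ-ℕtoℚ a))
      (*≡* (trans (ℤ.*-identityʳ _) (cong (ℤ._*_ (ℤ.+ a)) (cong ℤ.+_ (sym (*-identityʳ (suc d-1)))))))))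
clears-denominator (mkℚ ℤ.-[1+ a ] d-1 _) = 1 , s≤s z≤n , 0 , λ { (ℚ.*≤* ()) }

clears-* : ∀ d q e → Clears d q → Clears (e * d) q
clears-* d q e (N , eq) = e * N , λ 0≤q → begin
  q *ℚ ℕtoℚ (e * d)          ≡⟨ cong (λ z → q *ℚ ℕtoℚ z) (*-comm e d) ⟩
  q *ℚ ℕtoℚ (d * e)          ≡⟨ cong (q *ℚ_) (ℕtoℚ-* d e) ⟨
  q *ℚ (ℕtoℚ d *ℚ ℕtoℚ e)    ≡⟨ ℚ.*-assoc q _ _ ⟨
  q *ℚ ℕtoℚ d *ℚ ℕtoℚ e      ≡⟨ cong (_*ℚ ℕtoℚ e) (eq 0≤q) ⟩
  ℕtoℚ N *ℚ ℕtoℚ e           ≡⟨ ℕtoℚ-* N e ⟩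
  ℕtoℚ (N * e)               ≡⟨ cong ℕtoℚ (*-comm N e) ⟩
  ℕtoℚ (e * N)               ∎
  where open ≡-Reasoning

-- Stated for any property stable under multiples, since it is applied twice: over all `v` for a
-- fixed `u`, then over all `u`.
commonMultiple : ∀ {n} (P : Fin n → ℕ → Set) → (∀ i {d} e → P i d → P i (e * d)) →
  (∀ i → ∃ λ d → 0 < d × P i d) → ∃ λ d → 0 < d × (∀ i → P i d)
commonMultiple {zero}  P scale each = 1 , s≤s z≤n , λ ()
commonMultiple {suc n} P scale each
  with each zero | commonMultiple (λ i → P (suc i)) (λ i → scale (suc i)) (λ i → each (suc i))
... | suc d , _ , p | suc e , _ , ps = suc e * suc d , s≤s z≤n , λ
  { zero    → scale zero (suc e) p
  ; (suc i) → subst (P (suc i)) (*-comm (suc d) (suc e)) (scale (suc i) (suc d) (ps i)) }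

sumIf-scale : ∀ n {P : Fin n → Set} (P? : ∀ i → Dec (P i)) (f : Fin n → ℚ) (F : Fin n → ℕ) D →
  (∀ i → P i → f i *ℚ ℕtoℚ D ≡ ℕtoℚ (F i)) → sumIf n P? f *ℚ ℕtoℚ D ≡ ℕtoℚ (∑ (λ i → χ (P? i) * F i))
sumIf-scale zero    P? f F D eq = ℚ.*-zeroˡ (ℕtoℚ D)
sumIf-scale (suc n) P? f F D eq with P? zero
... | no _  = trans (cong (_*ℚ ℕtoℚ D) (ℚ.+-identityˡ rest)) (sumIf-scale n (P? ∘ suc) (f ∘ suc) (F ∘ suc) D (λ i → eq (suc i)))
  where rest = sumIf n (P? ∘ suc) (f ∘ suc)
... | yes p = begin
  (f zero +ℚ rest) *ℚ ℕtoℚ D             ≡⟨ ℚ.*-distribʳ-+ (ℕtoℚ D) (f zero) rest ⟩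
  f zero *ℚ ℕtoℚ D +ℚ rest *ℚ ℕtoℚ D     ≡⟨ cong₂ _+ℚ_ (eq zero p) (sumIf-scale n (P? ∘ suc) (f ∘ suc) (F ∘ suc) D (λ i → eq (suc i))) ⟩
  ℕtoℚ (F zero) +ℚ ℕtoℚ ∑rest            ≡⟨ ℕtoℚ-+ (F zero) ∑rest ⟩
  ℕtoℚ (F zero + ∑rest)                  ≡⟨ cong (λ z → ℕtoℚ (z + ∑rest)) (+-identityʳ (F zero)) ⟨
  ℕtoℚ (F zero + 0 + ∑rest)              ∎
  where
  open ≡-Reasoning
  rest  = sumIf n (P? ∘ suc) (f ∘ suc)
  ∑rest = ∑ (λ i → χ (P? (suc i)) * F (suc i))

record IntegerLP {n : ℕ} (E : Fin n → Fin n → Set) (E? : ∀ u v → Dec (E u v))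
                 (S : Subset n) (cap : Fin n → ℕ) (k : ℕ) : Set where
  field
    D        : ℕ
    0<D      : 0 < D
    X        : Fin n → Fin n → ℕ
    Y        : Fin n → ℕ
    total    : ∑ (λ u → χ (u ∈? S) * Y u) ≡ k * D
    X≤Y      : ∀ u v → u ∈ S → v ∈ S → X u v ≤ Y u
    capacity : ∀ u → u ∈ S → ∑ (λ v → χ ((v ∈? S) ×-dec E? u v) * X u v) ≤ cap u * Y u
    covered  : ∀ v → v ∈ S → ∑ (λ u → χ ((u ∈? S) ×-dec E? u v) * X u v) ≡ D
    Y≤D      : ∀ u → u ∈ S → Y u ≤ D

integerLP : ∀ {n E} {E? : ∀ u v → Dec (E u v)} {S : Subset n} {cap k} →
            LPFeasible E E? S cap k → IntegerLP E E? S cap k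
integerLP {n} {E} {E?} {S} {cap} {k} (x , y , Σy , x≤y , Σx≤ , Σx≡ , x-range , y-range) = record
  { D = D ; 0<D = proj₁ (proj₂ common) ; X = X ; Y = Y
  ; total = ℕtoℚ-injective (begin
      ℕtoℚ (∑ (λ u → χ (u ∈? S) * Y u))    ≡⟨ sumIf-scale n (_∈? S) y Y D yD ⟨
      sumIf n (_∈? S) y *ℚ ℕtoℚ D          ≡⟨ cong (_*ℚ ℕtoℚ D) Σy ⟩
      ℕtoℚ k *ℚ ℕtoℚ D                     ≡⟨ ℕtoℚ-* k D ⟩
      ℕtoℚ (k * D)                         ∎)
  ; X≤Y = λ u v u∈ v∈ → ℕtoℚ-cancel-≤ (subst₂ _≤ℚ_ (xD u v u∈ v∈) (yD u u∈) (*ℕtoℚ-mono-≤ D (x≤y u v u∈ v∈)))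
  ; capacity = λ u u∈ → ℕtoℚ-cancel-≤ (subst₂ _≤ℚ_
      (sumIf-scale n (λ v → (v ∈? S) ×-dec E? u v) (x u) (X u) D (λ v (v∈ , _) → xD u v u∈ v∈))
      (trans (ℚ.*-assoc (ℕtoℚ (cap u)) (y u) (ℕtoℚ D)) (trans (cong (ℕtoℚ (cap u) *ℚ_) (yD u u∈)) (ℕtoℚ-* (cap u) (Y u))))
      (*ℕtoℚ-mono-≤ D (Σx≤ u u∈)))
  ; covered = λ v v∈ → ℕtoℚ-injective (trans
      (sym (sumIf-scale n (λ u → (u ∈? S) ×-dec E? u v) (λ u → x u v) (λ u → X u v) D (λ u (u∈ , _) → xD u v u∈ v∈)))
      (trans (cong (_*ℚ ℕtoℚ D) (Σx≡ v v∈)) (ℚ.*-identityˡ (ℕtoℚ D))))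
  ; Y≤D = λ u u∈ → ℕtoℚ-cancel-≤ (subst₂ _≤ℚ_ (yD u u∈) (ℚ.*-identityˡ (ℕtoℚ D)) (*ℕtoℚ-mono-≤ D (proj₂ (y-range u u∈))))
  }
  where
  open ≡-Reasoning
  common = commonMultiple (λ u d → Clears d (y u) × (∀ v → Clears d (x u v)))
    (λ u {d} e (p , q) → clears-* d (y u) e p , λ v → clears-* d (x u v) e (q v))
    -- `Clears d (y u)` is carried along for every `v` and read off at `v = u`.
    (λ u → let (d , 0<d , p) = commonMultiple (λ v d → Clears d (y u) × Clears d (x u v))
                 (λ v {d} e (p , q) → clears-* d (y u) e p , clears-* d (x u v) e q) pair
           in d , 0<d , proj₁ (p u) , λ v → proj₂ (p v))
    where
    pair : ∀ {u} v → ∃ λ d → 0 < d × Clears d (y u) × Clears d (x u v)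
    pair {u} v with clears-denominator (y u) | clears-denominator (x u v)
    ... | suc d , _ , p | suc e , _ , q = suc e * suc d , s≤s z≤n , clears-* (suc d) (y u) (suc e) p
      , subst (λ z → Clears z (x u v)) (*-comm (suc d) (suc e)) (clears-* (suc e) (x u v) (suc d) q)
  D = proj₁ common
  Y : Fin n → ℕ
  Y u = proj₁ (proj₁ (proj₂ (proj₂ common) u))
  X : Fin n → Fin n → ℕ
  X u v = proj₁ (proj₂ (proj₂ (proj₂ common) u) v)
  yD : ∀ u → u ∈ S → y u *ℚ ℕtoℚ D ≡ ℕtoℚ (Y u)
  yD u u∈ = proj₂ (proj₁ (proj₂ (proj₂ common) u)) (proj₁ (y-range u u∈))
  xD : ∀ u v → u ∈ S → v ∈ S → x u v *ℚ ℕtoℚ D ≡ ℕtoℚ (X u v)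
  xD u v u∈ v∈ = proj₂ (proj₂ (proj₂ (proj₂ common) u) v) (proj₁ (x-range u v u∈ v∈))

-- List weights against finite sums.

wt-replicate : {A : Set} (f : A → ℕ) (k : ℕ) (x : A) → wt f (replicate k x) ≡ k * f x
wt-replicate f zero    x = refl
wt-replicate f (suc k) x = cong (f x +_) (wt-replicate f k x)

wt-filter : {A : Set} {P : A → Set} (P? : ∀ x → Dec (P x)) (f : A → ℕ) (xs : List A) →
            wt f (filter P? xs) ≡ wt (λ x → χ (P? x) * f x) xs
wt-filter P? f [] = refl
wt-filter P? f (x ∷ xs) with P? x
... | yes _ = cong₂ _+_ (sym (+-identityʳ (f x))) (wt-filter P? f xs)
... | no _  = wt-filter P? f xs

wt-partition : {A : Set} {P : A → Set} (P? : ∀ x → Dec (P x)) (f : A → ℕ) (xs : List A) →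
               wt f (filter P? xs) + wt f (filter (¬? ∘ P?) xs) ≡ wt f xs
wt-partition P? f [] = refl
wt-partition P? f (x ∷ xs) with P? x
... | yes _ = trans (+-assoc (f x) _ _) (cong (f x +_) (wt-partition P? f xs))
... | no _  = trans (swap (wt f (filter P? xs)) (f x) _) (cong (f x +_) (wt-partition P? f xs))
  where
  swap : ∀ a b c → a + (b + c) ≡ b + (a + c)
  swap = solve-∀

wt-allFin : ∀ {n} (f : Fin n → ℕ) → wt f (allFin n) ≡ ∑ f
wt-allFin f = trans (cong sum (map-tabulate id f)) (sum-tabulate f)
  where
  sum-tabulate : ∀ {n} (f : Fin n → ℕ) → sum (tabulate f) ≡ ∑ f
  sum-tabulate {zero}  f = refl
  sum-tabulate {suc n} f = cong (f zero +_) (sum-tabulate (f ∘ suc))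

-- The head `x` pays for `g x`, after which `g` is set to 0 there; repeated entries can only add to
-- the right-hand side.
∑≤wt : ∀ {n} (g f : Fin n → ℕ) (xs : List (Fin n)) → (∀ u → g u ≤ f u) → (∀ u → u ∉ₗ xs → g u ≡ 0) → ∑ g ≤ wt f xs
∑≤wt g f [] g≤f g∉ = ∑≤0 (λ u → ≤-reflexive (g∉ u λ ()))
∑≤wt {n} g f (x ∷ xs) g≤f g∉ = begin
  ∑ g                                                            ≤⟨ ∑-mono pointwise ⟩
  ∑ (λ u → χ (u ≟ x) * f u + χ (¬? (u ≟ x)) * g u)               ≡⟨ ∑-distrib-+ {n} _ _ ⟩
  ∑ (λ u → χ (u ≟ x) * f u) + ∑ (λ u → χ (¬? (u ≟ x)) * g u)     ≡⟨ cong (_+ ∑ (λ u → χ (¬? (u ≟ x)) * g u)) (∑-δ x f) ⟩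
  f x + ∑ (λ u → χ (¬? (u ≟ x)) * g u)                           ≤⟨ +-monoʳ-≤ (f x) (∑≤wt _ f xs
      (λ u → χ*≤ (¬? (u ≟ x)) (λ _ → g≤f u)) off) ⟩
  f x + wt f xs                                                  ∎
  where
  open ≤-Reasoning
  pointwise : ∀ u → g u ≤ χ (u ≟ x) * f u + χ (¬? (u ≟ x)) * g u
  pointwise u with u ≟ x
  ... | yes _ = ≤-trans (g≤f u) (≤-trans (m≤m+n (f u) 0) (m≤m+n _ 0))
  ... | no _  = m≤m+n (g u) 0
  off : ∀ u → u ∉ₗ xs → χ (¬? (u ≟ x)) * g u ≡ 0
  off u u∉ with u ≟ x
  ... | yes _  = refl
  ... | no u≢x = trans (+-identityʳ (g u)) (g∉ u λ { (here eq) → u≢x eq ; (there u∈) → u∉ u∈ })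

-- Walks and bounded distances.

module _ {n : ℕ} {E : Fin n → Fin n → Set} where

  walk-++ : ∀ {a b u v w} → Walk E a u v → Walk E b v w → Walk E (a + b) u w
  walk-++ here       q = q
  walk-++ (step e p) q = step e (walk-++ p q)

  walk-reverse : (∀ {u v} → E u v → E v u) → ∀ {a u v} → Walk E a u v → Walk E a v u
  walk-reverse E-sym here = here
  walk-reverse E-sym {u = u} {v} (step {m} e p) =
    subst (λ l → Walk E l v u) (+-comm m 1) (walk-++ (walk-reverse E-sym p) (step (E-sym e) here))

  -- Used to find the next centre: with `P` meaning adjacency to a key, the edge leads from a
  -- dominated vertex to an undominated one.
  crossing : {P : Fin n → Set} (P? : ∀ x → Dec (P x)) → ∀ {a u v} → Walk E a u v → P u → ¬ P v →
             ∃₂ λ x y → E x y × P x × ¬ P y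
  crossing P? here pu ¬pv = ⊥-elim (¬pv pu)
  crossing P? (step {u = u} {w} e p) pu ¬pv with P? w
  ... | yes pw = crossing P? p pw ¬pv
  ... | no ¬pw = u , w , e , pu , ¬pw

  dist-refl : ∀ {u} → DistLe E u u 0
  dist-refl = 0 , z≤n , here

  dist-sym : (∀ {u v} → E u v → E v u) → ∀ {a u v} → DistLe E u v a → DistLe E v u a
  dist-sym E-sym (m , m≤a , p) = m , m≤a , walk-reverse E-sym p

  dist-trans : ∀ {a b u v w} → DistLe E u v a → DistLe E v w b → DistLe E u w (a + b)
  dist-trans (m , m≤a , p) (m' , m'≤b , q) = m + m' , +-mono-≤ m≤a m'≤b , walk-++ p q

  dist-mono : ∀ {a b u v} → a ≤ b → DistLe E u v a → DistLe E u v b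
  dist-mono a≤b (m , m≤a , p) = m , ≤-trans m≤a a≤b , p

  dist-edge : ∀ {u v} → E u v → DistLe E u v 1
  dist-edge e = 1 , ≤-refl , step e here

  dist? : (∀ u v → Dec (E u v)) → ∀ d u v → Dec (DistLe E u v d)
  dist? E? zero u v with u ≟ v
  ... | yes refl = yes dist-refl
  ... | no u≢v   = no λ { (_ , z≤n , here) → u≢v refl }
  dist? E? (suc d) u v with u ≟ v | any? (λ w → E? u w ×-dec dist? E? d w v)
  ... | yes refl | _                            = yes (dist-mono z≤n dist-refl)
  ... | no _     | yes (w , e , m , m≤d , p)    = yes (suc m , s≤s m≤d , step e p)
  ... | no u≢v   | no ¬w = no λ { (_ , _ , here) → u≢v refl
                                ; (_ , s≤s m≤d , step e p) → ¬w (_ , e , _ , m≤d , p) }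

-- Cardinalities and subsets of prescribed size.

countIf≡∑ : ∀ n {P : Fin n → Set} (P? : ∀ i → Dec (P i)) → countIf n P? ≡ ∑ (λ i → χ (P? i))
countIf≡∑ zero    P? = refl
countIf≡∑ (suc n) P? with P? zero
... | yes _ = cong suc (countIf≡∑ n (λ i → P? (suc i)))
... | no _  = countIf≡∑ n (λ i → P? (suc i))

size≡∣∣ : ∀ {n} (A : Subset n) → size A ≡ ∣ A ∣
size≡∣∣ []            = refl
size≡∣∣ (inside ∷ A)  = cong suc (size≡∣∣ A)
size≡∣∣ (outside ∷ A) = size≡∣∣ A

-- The routing opens at most `k` vertices, whereas exactly `k` are wanted; the missing ones are
-- added from `S`.
interpolate : ∀ {n k} (O S : Subset n) → O ⊆ S → ∣ O ∣ ≤ k → k ≤ ∣ S ∣ → ∃ λ T → O ⊆ T × T ⊆ S × ∣ T ∣ ≡ k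
interpolate [] [] _ _ z≤n = [] , id , id , refl
interpolate (inside ∷ O) (outside ∷ S) O⊆S |O| |S| with () ← O⊆S here
interpolate (inside ∷ O) (inside ∷ S) O⊆S (s≤s |O|) (s≤s |S|) with interpolate O S (drop-∷-⊆ O⊆S) |O| |S|
... | T , O⊆T , T⊆S , |T| = inside ∷ T , s⊆s O⊆T , s⊆s T⊆S , cong suc |T|
interpolate (outside ∷ O) (outside ∷ S) O⊆S |O| |S| with interpolate O S (drop-∷-⊆ O⊆S) |O| |S|
... | T , O⊆T , T⊆S , |T| = outside ∷ T , s⊆s O⊆T , s⊆s T⊆S , |T|
-- An element outside `O` is added only if the rest of `S` has fewer than `k` elements; then so has
-- `O`, which leaves room for it.
interpolate {k = k} (outside ∷ O) (inside ∷ S) O⊆S |O| |S| with k ≤? ∣ S ∣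
... | yes k≤ with interpolate O S (drop-∷-⊆ O⊆S) |O| k≤
...   | T , O⊆T , T⊆S , |T| = outside ∷ T , s⊆s O⊆T , out⊆ T⊆S , |T|
interpolate {k = zero} (outside ∷ O) (inside ∷ S) O⊆S |O| |S| | no k≰ = contradiction z≤n k≰
interpolate {k = suc k} (outside ∷ O) (inside ∷ S) O⊆S |O| (s≤s k≤) | no k≰
  with interpolate O S (drop-∷-⊆ O⊆S) (≤-trans (p⊆q⇒∣p∣≤∣q∣ (drop-∷-⊆ O⊆S)) (≤-pred (≰⇒> k≰))) k≤
... | T , O⊆T , T⊆S , |T| = inside ∷ T , out⊆ O⊆T , s⊆s T⊆S , cong suc |T|

wt-bounded : {A : Set} (f : A → ℕ) {c : ℕ} {xs : List A} → All (λ x → f x ≤ c) xs → wt f xs ≤ length xs * c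
wt-bounded f []       = z≤n
wt-bounded f (p ∷ ps) = +-mono-≤ p (wt-bounded f ps)

-- Growing the clusters

module Growth {n : ℕ} (E : Fin n → Fin n → Set) (E? : ∀ u v → Dec (E u v)) (S : Subset n) (cap : Fin n → ℕ) (k : ℕ)
  (lp : IntegerLP E E? S cap k)
  (E-sym : ∀ {u v} → E u v → E v u)
  (E-loop : ∀ {u} → ¬ cap u ≡ 0 → E u u)
  (E-pos : ∀ {u v} → E u v → ¬ cap u ≡ 0 ⊎ ¬ cap v ≡ 0)
  (component : IsComponent E S) where

  open IntegerLP lp

  V : Set
  V = Fin n

  A : V → V → Set
  A = AdjIn E S

  A-sym : ∀ {u v} → A u v → A v u
  A-sym (u∈ , v∈ , e) = v∈ , u∈ , E-sym e

  Near : ℕ → V → V → Set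
  Near d u v = DistLe A u v d

  Pos : V → Set
  Pos u = u ∈ S × ¬ cap u ≡ 0

  Pos? : ∀ u → Dec (Pos u)
  Pos? u = (u ∈? S) ×-dec ¬? (cap u ℕ.≟ 0)

  -- The capacity constraint bounds a sum containing this term by 0. So a vertex of capacity 0
  -- serves nobody, even where `Y u` is positive.
  zero-cap : ∀ {u v} → u ∈ S → v ∈ S → E u v → cap u ≡ 0 → X u v ≡ 0
  zero-cap {u} {v} u∈ v∈ e c≡0 = n≤0⇒n≡0 (begin
    X u v                                          ≡⟨ χ* ((v ∈? S) ×-dec E? u v) (X u v) (v∈ , e) ⟨
    χ ((v ∈? S) ×-dec E? u v) * X u v              ≤⟨ term≤∑ (λ v → χ ((v ∈? S) ×-dec E? u v) * X u v) v ⟩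
    ∑ (λ v → χ ((v ∈? S) ×-dec E? u v) * X u v)    ≤⟨ capacity u u∈ ⟩
    cap u * Y u                                    ≡⟨ cong (_* Y u) c≡0 ⟩
    0                                              ∎)
    where open ≤-Reasoning

  -- The covering constraint splits `D` into flows `X u w`, each at most `Y u`, and those from
  -- capacity 0 vanish.
  neighbourhood-mass : ∀ {w} → w ∈ S → D ≤ ∑ (λ u → χ (Pos? u ×-dec E? u w) * Y u)
  neighbourhood-mass {w} w∈ = ≤-trans (≤-reflexive (sym (covered w w∈)))
    (∑-mono (λ u → χ*≤ ((u ∈? S) ×-dec E? u w) (bound u)))
    where
    bound : ∀ u → u ∈ S × E u w → X u w ≤ χ (Pos? u ×-dec E? u w) * Y u
    bound u (u∈ , e) with cap u ℕ.≟ 0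
    ... | yes c≡0 = ≤-trans (≤-reflexive (zero-cap u∈ w∈ e c≡0)) z≤n
    ... | no c≢0  = ≤-trans (X≤Y u w u∈ w∈) (≤-reflexive (sym (χ* (Pos? u ×-dec E? u w) (Y u) ((u∈ , c≢0) , e))))

  Meets : Subset n → V → Set
  Meets B u = ∃ λ v → v ∈ B × E u v

  meets? : ∀ B u → Dec (Meets B u)
  meets? B u = any? (λ v → (v ∈? B) ×-dec E? u v)

  -- Double counting of the flow into `B`: each demand receives `D`, while `u` sends at most
  -- `cap u * Y u`, and nothing if it has no neighbour in `B`.
  demand≤supply : ∀ B → B ⊆ S → size B * D ≤ ∑ (λ u → χ (Pos? u) * (χ (meets? B u) * (cap u * Y u)))
  demand≤supply B B⊆S = begin
    size B * D
      ≡⟨ *-distribʳ-sum {n} D _ ⟩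
    ∑ (λ v → χ (v ∈? B) * D)
      ≤⟨ ∑-mono (λ v → χ*≤ (v ∈? B) (λ v∈B → ≤-reflexive (trans (sym (covered v (B⊆S v∈B))) (sym (χ* (v ∈? B) _ v∈B))))) ⟩
    ∑ (λ v → χ (v ∈? B) * ∑ (λ u → flow u v))
      ≡⟨ sum-cong-≗ (λ v → *-distribˡ-sum {n} (χ (v ∈? B)) _) ⟩
    ∑ (λ v → ∑ (λ u → χ (v ∈? B) * flow u v))
      ≡⟨ ∑-comm {n} {n} _ ⟩
    ∑ (λ u → ∑ (λ v → χ (v ∈? B) * flow u v))
      ≤⟨ ∑-mono out ⟩
    ∑ (λ u → χ (Pos? u) * (χ (meets? B u) * (cap u * Y u))) ∎
    where
    open ≤-Reasoning
    flow : V → V → ℕ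
    flow u v = χ ((u ∈? S) ×-dec E? u v) * X u v
    out : ∀ u → ∑ (λ v → χ (v ∈? B) * flow u v) ≤ χ (Pos? u) * (χ (meets? B u) * (cap u * Y u))
    out u with (u ∈? S) ×-dec meets? B u
    ... | no ¬p = ≤-trans (∑≤0 (λ v → χ*≤ (v ∈? B) (λ v∈B → χ*≤ ((u ∈? S) ×-dec E? u v)
                     (λ (u∈ , e) → ⊥-elim (¬p (u∈ , v , v∈B , e)))))) z≤n
    ... | yes (u∈ , hit) = begin
      ∑ (λ v → χ (v ∈? B) * flow u v)                ≤⟨ ∑-mono widen ⟩
      ∑ (λ v → χ ((v ∈? S) ×-dec E? u v) * X u v)    ≤⟨ capacity u u∈ ⟩
      cap u * Y u                                    ≤⟨ charge ⟩
      χ (Pos? u) * (χ (meets? B u) * (cap u * Y u))  ∎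
      where
      widen : ∀ v → χ (v ∈? B) * flow u v ≤ χ ((v ∈? S) ×-dec E? u v) * X u v
      widen v = χ*≤ (v ∈? B) (λ v∈B → χ*≤ ((u ∈? S) ×-dec E? u v)
        (λ (_ , e) → ≤-reflexive (sym (χ* ((v ∈? S) ×-dec E? u v) (X u v) (B⊆S v∈B , e)))))
      charge : cap u * Y u ≤ χ (Pos? u) * (χ (meets? B u) * (cap u * Y u))
      charge with cap u ℕ.≟ 0
      ... | yes c≡0 = ≤-trans (≤-reflexive (cong (_* Y u) c≡0)) z≤n
      ... | no c≢0  = ≤-reflexive (sym (trans (χ* (Pos? u) _ (u∈ , c≢0)) (χ* (meets? B u) _ hit)))

  open Transfer {V} Near (dist-sym A-sym) dist-trans dist-mono D public

  tokenWeight : Weight → V → ℕ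
  tokenWeight f u = Y u * f u

  -- Greedy reservation of `d` tokens as units: each `w` gives as many as still needed and keeps the
  -- rest, at distance 0, in its own bucket. The clause for `Q` transfers properties of the owners,
  -- such as closeness to the centre, to the units.
  fill : ∀ d ws → All Pos ws → ∃₂ λ (us : List V) (bs : All Bucket (map mem ws)) →
    (d ≤ wt Y ws → length us ≡ d) ×
    (∀ {Q : V → Set} → All Q ws → All Q us) ×
    (∀ f → bucketsTok f bs + wt f us ≡ wt (tokenWeight f) ws) ×
    (∀ f → bucketsLoc f bs ≡ wt f ws)
  fill d [] [] = [] , [] , (λ { z≤n → refl }) , (λ _ → []) , (λ _ → refl) , λ _ → refl
  fill d (w ∷ ws) ((w∈ , _) ∷ ps) with fill (d ∸ Y w) ws ps
  ... | us , bs , len , near , tok , loc =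
    replicate (d ⊓ Y w) w ++ us
    , load (replicate (Y w ∸ d) w) (All.replicate⁺ _ (dist-mono z≤n dist-refl))
        (≤-trans (≤-reflexive (length-replicate _)) (≤-trans (m∸n≤m (Y w) d) (Y≤D w w∈))) ∷ bs
    , (λ d≤ → trans (length-++ (replicate (d ⊓ Y w) w))
                (trans (cong₂ _+_ (length-replicate _) (len (m≤n+o⇒m∸n≤o d (Y w) d≤)))
                (trans (cong (_+ (d ∸ Y w)) (⊓-comm d (Y w))) (m⊓n+n∸m≡n (Y w) d))))
    , (λ { (q ∷ qs) → All.++⁺ (All.replicate⁺ _ q) (near qs) })
    , (λ f → trans (cong₂ _+_ (cong (_+ bucketsTok f bs) (wt-replicate f (Y w ∸ d) w))
                              (trans (wt-++ f (replicate (d ⊓ Y w) w) us) (cong (_+ wt f us) (wt-replicate f (d ⊓ Y w) w))))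
         (trans (regroup (Y w ∸ d) (d ⊓ Y w) (f w) (bucketsTok f bs) (wt f us))
           (cong₂ _+_ (cong (_* f w) (m⊓n+n∸m≡n d (Y w))) (tok f))))
    , λ f → cong (f w +_) (loc f)
    where
    regroup : ∀ a b c x y → a * c + x + (b * c + y) ≡ (b + a) * c + (x + y)
    regroup = solve-∀

  record NewCluster (m r : V) (xs : List V) : Set where
    field
      cluster   : Cluster
      centre≡   : Cluster.centre cluster ≡ m
      delegate≡ : Cluster.delegate cluster ≡ r
      buckets   : All Bucket (keys cluster)
      tok       : ∀ f → bucketsTok f buckets + wt f (Cluster.units cluster) ≡ wt (tokenWeight f) xs
      loc       : ∀ f → bucketsLoc f buckets + f r ≡ wt f xs
      all-keys  : ∀ {u} → u ∈ₗ xs → Any (λ κ → vertex κ ≡ u) (keys cluster)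
      keys-pos  : All (λ κ → Pos (vertex κ)) (keys cluster)

  -- The delegate `r` gives all its tokens as units, at most `D` of them, so its bucket starts empty
  -- and its location can travel with the units. The other vertices supply the missing `D ∸ Y r`.
  newCluster : ∀ {m r} xs → m ∈ S → All (λ u → Pos u × E u m) xs → D ≤ wt Y xs → r ∈ₗ xs → NewCluster m r xs
  newCluster {m} {r} xs m∈ xs~ D≤ r∈ with ∈-∃++ r∈
  ... | as , bs , refl with All.++⁻ as xs~
  ... | as~ , ((r∈S , r-pos) , r~) ∷ bs~ with fill (D ∸ Y r) (as ++ bs) (All.map proj₁ (All.++⁺ as~ bs~))
  ... | us , bks , len , near , tok' , loc' = record
    { cluster = record
        { centre = m ; delegate = r ; members = as ++ bs ; units = replicate (Y r) r ++ us
        ; delegate~ = edge (((r∈S , r-pos) , r~))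
        ; members~ = members~
        ; units~ = All.++⁺ (All.replicate⁺ (Y r) (edge ((r∈S , r-pos) , r~))) (near members~)
        ; |units| = trans (length-++ (replicate (Y r) r)) (trans (cong₂ _+_ (length-replicate (Y r))
            (len (m≤n+o⇒m∸n≤o D (Y r) (≤-trans D≤ (≤-reflexive (middle Y)))))) (m+[n∸m]≡n (Y≤D r r∈S))) }
    ; centre≡ = refl ; delegate≡ = refl
    ; buckets = empty ∷ bks
    ; tok = λ f → trans (cong (bucketsTok f bks +_)
          (trans (wt-++ f (replicate (Y r) r) us) (cong (_+ wt f us) (wt-replicate f (Y r) r))))
        (trans (swap (bucketsTok f bks) (Y r * f r) (wt f us))
        (trans (cong (Y r * f r +_) (tok' f)) (sym (middle (tokenWeight f)))))
    ; loc = λ f → trans (+-comm (bucketsLoc f bks) (f r)) (trans (cong (f r +_) (loc' f)) (sym (middle f)))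
    ; all-keys = locate
    ; keys-pos = (r∈S , r-pos) ∷ All.map⁺ (All.map proj₁ (All.++⁺ as~ bs~))
    }
    where
    edge : ∀ {u} → Pos u × E u m → Near 1 u m
    edge ((u∈ , _) , e) = dist-edge (u∈ , m∈ , e)
    members~ : All (λ w → Near 1 w m) (as ++ bs)
    members~ = All.map edge (All.++⁺ as~ bs~)
    swap : ∀ a b c → a + (b + c) ≡ b + (a + c)
    swap = solve-∀
    middle : ∀ (f : V → ℕ) → wt f (as ++ r ∷ bs) ≡ f r + wt f (as ++ bs)
    middle f = trans (wt-++ f as (r ∷ bs)) (trans (swap (wt f as) (f r) (wt f bs)) (cong (f r +_) (sym (wt-++ f as bs))))
    locate : ∀ {u} → u ∈ₗ as ++ r ∷ bs → Any (λ κ → vertex κ ≡ u) (rep r ∷ map mem (as ++ bs))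
    locate u∈ with Any.++⁻ as u∈
    ... | inj₁ u∈as         = there (Any.map⁺ (Any.map sym (Any.++⁺ˡ u∈as)))
    ... | inj₂ (here eq)    = here (sym eq)
    ... | inj₂ (there u∈bs) = there (Any.map⁺ (Any.map sym (Any.++⁺ʳ as u∈bs)))

  candidates : List V
  candidates = filter Pos? (allFin n)

  wt-candidates : ∀ f → wt f candidates ≡ ∑ (λ u → χ (Pos? u) * f u)
  wt-candidates f = trans (wt-filter Pos? f (allFin n)) (wt-allFin {n} (λ u → χ (Pos? u) * f u))

  Adjacent : List Key → V → Set
  Adjacent ks x = Any (λ κ → E (vertex κ) x) ks

  -- The invariant of the growth. In `tok` and `loc`, buckets, clusters and remaining vertices
  -- account for every candidate exactly once; `seed` is a dominated vertex from which walks to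
  -- undominated ones can start.
  record Grown : Set where
    field
      ks        : List Key
      tree      : Tree ks
      buckets   : All Bucket ks
      remaining : List V
      keys-pos  : All (λ κ → Pos (vertex κ)) ks
      pos       : All Pos remaining
      tok       : ∀ f → bucketsTok f buckets + unitTok f tree + wt (tokenWeight f) remaining ≡ wt (tokenWeight f) candidates
      loc       : ∀ f → bucketsLoc f buckets + delegateLoc f tree + wt f remaining ≡ wt f candidates
      located   : ∀ {u} → Pos u → Any (λ κ → vertex κ ≡ u) ks ⊎ u ∈ₗ remaining
      seed      : V
      seed∈S    : seed ∈ S
      seed-adj  : Adjacent ks seed

  neighbours others : V → List V → List V
  neighbours m xs = filter (λ u → E? u m) xs
  others m xs     = filter (λ u → ¬? (E? u m)) xs

  neighbours~ : ∀ m {xs} → All Pos xs → All (λ u → Pos u × E u m) (neighbours m xs)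
  neighbours~ m {xs} ps = All.zip (All.filter⁺ (λ u → E? u m) ps , All.all-filter (λ u → E? u m) xs)

  neighbours-mass : ∀ {m xs} → m ∈ S → (∀ {u} → Pos u → E u m → u ∈ₗ xs) → D ≤ wt Y (neighbours m xs)
  neighbours-mass {m} {xs} m∈ complete = ≤-trans (neighbourhood-mass m∈)
    (∑≤wt _ Y (neighbours m xs) (λ u → χ*≤ (Pos? u ×-dec E? u m) (λ _ → ≤-refl))
      (λ u u∉ → cong (_* Y u) (χ≡0 (Pos? u ×-dec E? u m) (λ (p , e) → u∉ (∈-filter⁺ (λ u → E? u m) (complete p e) e)))))

  find-key : ∀ {ks} → All (λ κ → Pos (vertex κ)) ks → ∀ {P Q : Key → Set} →
    (∀ {κ} → Pos (vertex κ) → P κ → Q κ) → Any P ks → Any Q ks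
  find-key (p ∷ ps) f (here px)  = here (f p px)
  find-key (p ∷ ps) f (there px) = there (find-key ps f px)

  join-buckets : ∀ f {ks ks'} (bs : All Bucket ks) (bs' : All Bucket ks') →
    bucketsTok f (All.++⁺ bs bs') ≡ bucketsTok f bs + bucketsTok f bs' ×
    bucketsLoc f (All.++⁺ bs bs') ≡ bucketsLoc f bs + bucketsLoc f bs'
  join-buckets f []                 bs' = refl , refl
  join-buckets f (_∷_ {x = κ} b bs) bs' with join-buckets f bs bs'
  ... | t , l = trans (cong (bucketTok {κ} f b +_) t) (sym (+-assoc (bucketTok {κ} f b) _ _))
              , trans (cong (bucketLoc {κ} f b +_) l) (sym (+-assoc (bucketLoc {κ} f b) _ _))

  start : Grown
  -- The list owns at least `D > 0` tokens and so is non-empty; its first entry becomes the delegate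
  -- of the root.
  start with neighbours (proj₁ (proj₁ component)) candidates in eq
  ... | [] = contradiction (≤-trans 0<D (≤-trans (neighbours-mass (proj₂ (proj₁ component)) (λ {u} p _ → ∈-filter⁺ Pos? (∈-allFin u) p))
                              (≤-reflexive (cong (wt Y) eq)))) λ ()
  ... | r ∷ _ = record
    { ks = keys cluster ; tree = root cluster ; buckets = buckets ; remaining = others m candidates
    ; keys-pos = keys-pos ; pos = All.filter⁺ (λ u → ¬? (E? u m)) (All.all-filter Pos? (allFin n))
    ; tok = λ f → trans (cong (_+ wt (tokenWeight f) (others m candidates)) (tok f))
                        (wt-partition (λ u → E? u m) (tokenWeight f) candidates)
    ; loc = λ f → trans (cong (_+ wt f (others m candidates)) (trans (cong (bucketsLoc f buckets +_) (cong f delegate≡)) (loc f)))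
                        (wt-partition (λ u → E? u m) f candidates)
    ; located = locate
    ; seed = m ; seed∈S = m∈
    ; seed-adj = Any.map
        (λ eq' → subst (λ z → E z m) (sym eq') (proj₂ (∈-filter⁻ (λ u → E? u m) {xs = candidates} r∈))) (all-keys r∈)
    }
    where
    m = proj₁ (proj₁ component)
    m∈ = proj₂ (proj₁ component)
    r∈ : r ∈ₗ neighbours m candidates
    r∈ = subst (r ∈ₗ_) (sym eq) (here refl)
    open NewCluster (newCluster (neighbours m candidates) m∈ (neighbours~ m (All.all-filter Pos? (allFin n)))
      (neighbours-mass m∈ (λ {u} p _ → ∈-filter⁺ Pos? (∈-allFin u) p)) r∈)
    locate : ∀ {u} → Pos u → Any (λ κ → vertex κ ≡ u) (keys cluster) ⊎ u ∈ₗ others m candidates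
    locate {u} p with E? u m
    ... | yes e = inj₁ (all-keys (∈-filter⁺ (λ u → E? u m) (∈-filter⁺ Pos? (∈-allFin u) p) e))
    ... | no ¬e = inj₂ (∈-filter⁺ (λ u → ¬? (E? u m)) (∈-filter⁺ Pos? (∈-allFin u) p) ¬e)

  -- No key is adjacent to `m`, so its whole neighbourhood is still among the remaining vertices and
  -- can supply a cluster of its own. At least the delegate leaves that list, which gives the strict
  -- decrease.
  extend : (g : Grown) → let open Grown g in ∀ {x m} → A x m → Adjacent ks x → ¬ Adjacent ks m →
           Σ Grown λ g' → length (Grown.remaining g') < length remaining
  extend g {x} {m} (x∈ , m∈ , e) adj ¬adj = record
    { ks = keys cluster ++ ks ; tree = grow cluster link tree
    ; buckets = All.++⁺ buckets' buckets ; remaining = others m remaining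
    ; keys-pos = All.++⁺ keys-pos' keys-pos ; pos = All.filter⁺ _ pos
    ; tok = λ f → trans (cong (λ z → z + (wt f (Cluster.units cluster) + unitTok f tree) + wt (tokenWeight f) (others m remaining))
                                (proj₁ (join-buckets f buckets' buckets)))
        (trans (regroup (bucketsTok f buckets') (bucketsTok f buckets) _ _ _)
        (trans (cong (λ z → bucketsTok f buckets + unitTok f tree + (z + wt (tokenWeight f) (others m remaining))) (tok' f))
        (trans (cong (bucketsTok f buckets + unitTok f tree +_) (wt-partition (λ u → E? u m) (tokenWeight f) remaining)) (tok f))))
    ; loc = λ f → trans (cong (λ z → z + (f (Cluster.delegate cluster) + delegateLoc f tree) + wt f (others m remaining))
                                (proj₂ (join-buckets f buckets' buckets)))
        (trans (regroup (bucketsLoc f buckets') (bucketsLoc f buckets) _ _ _)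
        (trans (cong (λ z → bucketsLoc f buckets + delegateLoc f tree + (z + wt f (others m remaining)))
                     (trans (cong (bucketsLoc f buckets' +_) (cong f delegate≡)) (loc' f)))
        (trans (cong (bucketsLoc f buckets + delegateLoc f tree +_) (wt-partition (λ u → E? u m) f remaining)) (loc f))))
    ; located = locate
    ; seed = seed ; seed∈S = seed∈S ; seed-adj = Any.++⁺ʳ (keys cluster) seed-adj
    } , filter-notAll (λ u → ¬? (E? u m)) remaining
          (Any.map (λ { refl ¬e → ¬e (proj₂ r-mem) }) (proj₁ r-mem))
    where
    open Grown g

    not-key : ∀ {u} → E u m → ¬ Any (λ κ → vertex κ ≡ u) ks
    not-key e' i = ¬adj (Any.map (λ { refl → e' }) i)

    complete : ∀ {u} → Pos u → E u m → u ∈ₗ remaining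
    complete p e' with located p
    ... | inj₁ i  = ⊥-elim (not-key e' i)
    ... | inj₂ u∈ = u∈

    -- A centre of positive capacity has a loop and is its own delegate; otherwise the edge to `x`
    -- forces `x` to have positive capacity. Either is within 1 of `x`, hence within 2 of a key
    -- adjacent to `x`.
    choice : ∃ λ r → r ∈ₗ neighbours m remaining × Near 1 x r
    choice with cap m ℕ.≟ 0
    ... | no c≢0  = m , ∈-filter⁺ (λ u → E? u m) (complete (m∈ , c≢0) (E-loop c≢0)) (E-loop c≢0) , dist-edge (x∈ , m∈ , e)
    ... | yes c≡0 = x , ∈-filter⁺ (λ u → E? u m) (complete (x∈ , [ id , (λ c≢0 → ⊥-elim (c≢0 c≡0)) ] (E-pos e)) e) e
                      , dist-mono z≤n dist-refl

    r = proj₁ choice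

    open NewCluster (newCluster (neighbours m remaining) m∈ (neighbours~ m pos) (neighbours-mass m∈ complete) (proj₁ (proj₂ choice)))
      renaming (buckets to buckets'; keys-pos to keys-pos'; tok to tok'; loc to loc')

    r-mem : r ∈ₗ remaining × E r m
    r-mem = ∈-filter⁻ (λ u → E? u m) {xs = remaining} (proj₁ (proj₂ choice))

    regroup : ∀ a b c d e → a + b + (c + d) + e ≡ b + d + (a + c + e)
    regroup = solve-∀

    locate : ∀ {u} → Pos u → Any (λ κ → vertex κ ≡ u) (keys cluster ++ ks) ⊎ u ∈ₗ others m remaining
    locate {u} p with located p | E? u m
    ... | inj₁ i  | _      = inj₁ (Any.++⁺ʳ (keys cluster) i)
    ... | inj₂ u∈ | yes e' = inj₁ (Any.++⁺ˡ (all-keys (∈-filter⁺ (λ u → E? u m) u∈ e')))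
    ... | inj₂ u∈ | no ¬e  = inj₂ (∈-filter⁺ (λ u → ¬? (E? u m)) u∈ ¬e)

    link : Any (λ κ → Near 2 (Cluster.centre cluster) (vertex κ) × Near 2 (Cluster.delegate cluster) (vertex κ)) ks
    link = find-key keys-pos (λ (κ∈ , _) e' →
      let x~κ = dist-edge (x∈ , κ∈ , E-sym e') in
      subst (λ z → Near 2 z _) (sym centre≡) (dist-trans (dist-edge (m∈ , x∈ , E-sym e)) x~κ) ,
      subst (λ z → Near 2 z _) (sym delegate≡) (dist-trans (dist-sym A-sym (proj₂ (proj₂ choice))) x~κ)) adj

  Dominating : Grown → Set
  Dominating g = ∀ x → x ∈ S → Adjacent (Grown.ks g) x

  adjacent? : ∀ ks x → Dec (Adjacent ks x)
  adjacent? ks x = Any.any? (λ κ → E? (vertex κ) x) ks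

  improve : (g : Grown) → Dominating g ⊎ Σ Grown (λ g' → length (Grown.remaining g') < length (Grown.remaining g))
  improve g = decide (any? (λ x → (x ∈? S) ×-dec ¬? (adjacent? ks x)))
    where
    open Grown g
    decide : Dec (∃ λ x → x ∈ S × ¬ Adjacent ks x) → _
    decide (no none) = inj₁ (λ x x∈ → decidable-stable (adjacent? ks x) (λ ¬adj → none (x , x∈ , ¬adj)))
    -- By connectedness a walk leads from the dominated seed to `x`, and somewhere on it domination
    -- is lost.
    decide (yes (x , x∈ , ¬adj)) =
      let (_ , p) = proj₂ (proj₂ component) seed x seed∈S x∈
          (_ , _ , e , adj , ¬adj') = crossing (adjacent? ks) p seed-adj ¬adj
      in inj₂ (extend g e adj ¬adj')

  dominate : ∀ fuel (g : Grown) → length (Grown.remaining g) ≤ fuel → Σ Grown Dominating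
  dominate fuel g len with improve g
  dominate fuel       g len | inj₁ done      = g , done
  dominate zero       g len | inj₂ (g' , lt) = contradiction (≤-trans lt len) λ ()
  dominate (suc fuel) g len | inj₂ (g' , lt) = dominate fuel g' (≤-pred (≤-trans lt len))

  -- A vertex outside the clusters sends its tokens and its own location to an adjacent key;
  -- distance 1 is within both radii of a bucket.
  deliverAll : ∀ {ks} → All (λ κ → Pos (vertex κ)) ks → ∀ us → All Pos us → All (Adjacent ks) us → (bs : All Bucket ks) →
    Step (λ f → bucketsTok f bs + wt (tokenWeight f) us) (λ f → bucketsLoc f bs + wt f us) (All Bucket ks) bucketsTok bucketsLoc
  deliverAll ks-pos [] [] [] bs =
    reindex id (λ _ → sym (+-identityʳ _)) (λ _ → m≤m+n _ 0) (λ _ _ → refl) (λ _ _ → ≤-refl) (keep bs)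
  deliverAll ks-pos (u ∷ us) ((u∈ , _) ∷ ps) (adj ∷ adjs) bs =
    reindex id
      (λ f → trans (cong (λ z → bucketsTok f bs + z + wt (tokenWeight f) us) (wt-replicate f (Y u) u)) (+-assoc (bucketsTok f bs) _ _))
      (λ f → ≤-reflexive (+-assoc (bucketsLoc f bs) _ _)) (λ _ _ → refl) (λ _ _ → ≤-refl)
      (andThen (λ f → wt (tokenWeight f) us) (λ f → wt f us)
        (deliver (find-key ks-pos (λ (κ∈ , _) e → let u~κ = dist-edge (u∈ , κ∈ , E-sym e) in
                    dist-mono (n≤1+n 1) u~κ , All.replicate⁺ (Y u) (dist-mono (s≤s z≤n) u~κ)) adj)
                 (≤-trans (≤-reflexive (length-replicate (Y u))) (Y≤D u u∈)) bs)
        (deliverAll ks-pos us ps adjs))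

  -- Transport of all tokens to at most `k` locations.

  record Transferred : Set where
    field
      parcels : List Parcel
      valid   : All (λ (ℓ , ts) → length ts ≤ D × All (λ x → Near 5 x ℓ) ts) parcels
      tok     : ∀ f → tokW f parcels ≡ ∑ (λ u → χ (Pos? u) * (Y u * f u))
      loc     : ∀ f → locW f parcels ≤ ∑ (λ u → χ (Pos? u) * f u)
      few     : length parcels ≤ k

  size-full : ∀ {os} → All Full os → tokW (λ _ → 1) os ≡ length os * D
  size-full []              = refl
  size-full (_∷_ {x = _ , ts} (|ts| , _) fs) = cong₂ _+_ (trans (wt-1 ts) |ts|) (size-full fs)

  relax : ∀ {p} → Full p → length (proj₂ p) ≤ D × All (λ x → Near 5 x (proj₁ p)) (proj₂ p)
  relax (|ts| , near) = ≤-reflexive |ts| , near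

  -- If the final load is non-empty, the full parcels hold fewer than `k * D` tokens and number
  -- fewer than `k`, so one more location may be opened. If it is empty, its location must stay
  -- closed, as there may be `k` full parcels already.
  conclude : (s : Step (λ f → wt (tokenWeight f) candidates) (λ f → wt f candidates)
                       (Σ V (Load 5)) (λ f x → loadTok f (proj₂ x)) (λ f x → f (proj₁ x))) → Transferred
  conclude record { opened = os ; full = full ; result = ℓ , load ts near |ts| ; tok = tok ; loc = loc } =
    finalise ts near |ts| tok bound
    where
    supply≤ : wt (tokenWeight (λ _ → 1)) candidates ≤ k * D
    supply≤ = begin
      wt (tokenWeight (λ _ → 1)) candidates    ≡⟨ wt-candidates _ ⟩
      ∑ (λ u → χ (Pos? u) * (Y u * 1))         ≤⟨ ∑-mono (λ u → χ*≤ (Pos? u) (λ (u∈ , _) →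
          ≤-reflexive (trans (*-identityʳ (Y u)) (sym (χ* (u ∈? S) (Y u) u∈))))) ⟩
      ∑ (λ u → χ (u ∈? S) * Y u)               ≡⟨ total ⟩
      k * D                                    ∎
      where open ≤-Reasoning
    bound : length os * D + length ts ≤ k * D
    bound = ≤-trans (≤-reflexive (trans (cong₂ _+_ (sym (size-full full)) (sym (wt-1 ts))) (tok (λ _ → 1)))) supply≤
    finalise : ∀ ts → All (λ x → Near 5 x ℓ) ts → length ts ≤ D →
      (∀ f → tokW f os + wt f ts ≡ wt (tokenWeight f) candidates) → length os * D + length ts ≤ k * D → Transferred
    finalise [] _ _ tok bound = record
      { parcels = os ; valid = All.map relax full
      ; tok = λ f → trans (sym (+-identityʳ _)) (trans (tok f) (wt-candidates _))
      ; loc = λ f → ≤-trans (m≤m+n _ (f ℓ)) (≤-trans (loc f) (≤-reflexive (wt-candidates f)))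
      ; few = *-cancelʳ-≤ (length os) k D {{ℕ.>-nonZero 0<D}} (≤-trans (m≤m+n _ 0) bound) }
    finalise ts@(_ ∷ _) near |ts| tok bound = record
      { parcels = (ℓ , ts) ∷ os ; valid = (|ts| , near) ∷ All.map relax full
      ; tok = λ f → trans (+-comm (wt f ts) _) (trans (tok f) (wt-candidates _))
      ; loc = λ f → ≤-trans (≤-reflexive (+-comm (f ℓ) _)) (≤-trans (loc f) (≤-reflexive (wt-candidates f)))
      ; few = *-cancelʳ-< D (length os) k (≤-trans (≤-trans (≤-reflexive (+-comm 1 _))
                (+-monoʳ-≤ (length os * D) (s≤s z≤n))) bound) }

  transfer : Transferred
  transfer with dominate _ start ≤-refl
  ... | g , dominated =
    conclude (reindex id (λ f → trans (swap (bucketsTok f buckets) _ _) (tok f))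
                         (λ f → ≤-reflexive (trans (swap (bucketsLoc f buckets) _ _) (loc f)))
                         (λ _ _ → refl) (λ _ _ → ≤-refl)
      (andThen (λ f → unitTok f tree) (λ f → delegateLoc f tree)
        (deliverAll keys-pos remaining pos (All.map (λ {u} p → dominated u (proj₁ p)) pos) buckets)
        (solve tree)))
    where
    open Grown g
    swap : ∀ a b c → a + b + c ≡ a + c + b
    swap = solve-∀

  -- Rounding by Hall's theorem.

  module Rounding (L : ℕ) (zeroL : ZeroLInstance L cap) (transferred : Transferred) where
    open Transferred transferred

    pos⇒cap≡L : ∀ {u} → Pos u → cap u ≡ L
    pos⇒cap≡L {u} (_ , c≢0) with zeroL u
    ... | inj₁ c≡0 = ⊥-elim (c≢0 c≡0)
    ... | inj₂ c≡L = c≡L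

    occ : V → ℕ
    occ b = locW (λ v → χ (b ≟ v)) parcels

    -- The bound `loc` at the indicator of `b`: a vertex is opened at most once, and only if its
    -- capacity is positive.
    occ≤ : ∀ b → occ b ≤ χ (Pos? b)
    occ≤ b = begin
      occ b                                   ≤⟨ loc (λ v → χ (b ≟ v)) ⟩
      ∑ (λ u → χ (Pos? u) * χ (b ≟ u))        ≤⟨ ∑-mono swap ⟩
      ∑ (λ u → χ (u ≟ b) * χ (Pos? u))        ≡⟨ ∑-δ b (λ u → χ (Pos? u)) ⟩
      χ (Pos? b)                              ∎
      where
      open ≤-Reasoning
      swap : ∀ u → χ (Pos? u) * χ (b ≟ u) ≤ χ (u ≟ b) * χ (Pos? u)
      swap u = χ*≤ (Pos? u) (λ p → χ≤ (b ≟ u) (λ b≡u →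
        ≤-reflexive (sym (trans (χ* (u ≟ b) _ (sym b≡u)) (χ≡1 (Pos? u) p)))))

    locW≡∑ : ∀ g ps → locW g ps ≡ ∑ (λ b → locW (λ v → χ (b ≟ v)) ps * g b)
    locW≡∑ g []             = sym (n≤0⇒n≡0 (∑≤0 {n} (λ b → z≤n)))
    locW≡∑ g ((ℓ , _) ∷ ps) = sym (begin
      ∑ (λ b → (χ (b ≟ ℓ) + count b) * g b)                    ≡⟨ sum-cong-≗ {n} (λ b → *-distribʳ-+ (g b) (χ (b ≟ ℓ)) (count b)) ⟩
      ∑ (λ b → χ (b ≟ ℓ) * g b + count b * g b)                ≡⟨ ∑-distrib-+ {n} _ _ ⟩
      ∑ (λ b → χ (b ≟ ℓ) * g b) + ∑ (λ b → count b * g b)      ≡⟨ cong₂ _+_ (∑-δ ℓ g) (sym (locW≡∑ g ps)) ⟩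
      g ℓ + locW g ps                                          ∎)
      where
      open ≡-Reasoning
      count : V → ℕ
      count b = locW (λ v → χ (b ≟ v)) ps

    A? : ∀ u v → Dec (A u v)
    A? u v = (u ∈? S) ×-dec ((v ∈? S) ×-dec E? u v)

    module H = Hall (Near 6) (dist? A? 6) id

    slots : V → ℕ
    slots b = L * occ b

    -- Let every token owned by a neighbour of `B` weigh `L`, which amounts to at least
    -- `size B * D`. A parcel with such a token lies within 1 + 5 = 6 of `B` and weighs at most
    -- `D * L`, that is, `D` times the `L` slots it provides.
    hall-condition : H.HallCondition S slots
    hall-condition B B⊆S = *-cancelʳ-≤ _ _ D {{ℕ.>-nonZero 0<D}} (begin
      size B * D                                                            ≤⟨ demand≤supply B B⊆S ⟩
      ∑ (λ u → χ (Pos? u) * (χ (meets? B u) * (cap u * Y u)))               ≤⟨ ∑-mono charge ⟩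
      ∑ (λ u → χ (Pos? u) * (Y u * f u))                                    ≡⟨ tok f ⟨
      tokW f parcels                                                        ≤⟨ absorbed valid ⟩
      locW g parcels                                                        ≡⟨ locW≡∑ g parcels ⟩
      ∑ (λ b → occ b * g b)                                                 ≡⟨ sum-cong-≗ {n} (λ b → regroup (occ b) (χ (H.hit? B b)) L D) ⟩
      ∑ (λ b → χ (H.hit? B b) * slots b * D)                                ≡⟨ *-distribʳ-sum {n} D _ ⟨
      H.supply slots B * D                                                  ∎)
      where
      open ≤-Reasoning
      f g : V → ℕ
      f u = χ (Pos? u ×-dec meets? B u) * L
      g b = D * (χ (H.hit? B b) * L)
      regroup : ∀ o h l d → o * (d * (h * l)) ≡ h * (l * o) * d
      regroup = solve-∀
      charge : ∀ u → χ (Pos? u) * (χ (meets? B u) * (cap u * Y u)) ≤ χ (Pos? u) * (Y u * f u)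
      charge u = χ*≤ (Pos? u) (λ p → χ*≤ (meets? B u) (λ hit → ≤-reflexive (begin-equality
        cap u * Y u                      ≡⟨ *-comm (cap u) (Y u) ⟩
        Y u * cap u                      ≡⟨ cong (Y u *_) (pos⇒cap≡L p) ⟩
        Y u * L                          ≡⟨ cong (Y u *_) (χ* (Pos? u ×-dec meets? B u) L (p , hit)) ⟨
        Y u * f u                        ≡⟨ χ* (Pos? u) _ p ⟨
        χ (Pos? u) * (Y u * f u)         ∎)))
      near : ∀ {ℓ} u → Near 5 u ℓ → f u ≤ χ (H.hit? B ℓ) * L
      near {ℓ} u u~ℓ = χ*≤ (Pos? u ×-dec meets? B u) (λ ((u∈ , _) , v , v∈ , e) →
        ≤-reflexive (sym (χ* (H.hit? B ℓ) L (v , v∈ , dist-trans (dist-edge (B⊆S v∈ , u∈ , E-sym e)) u~ℓ))))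
      absorbed : ∀ {ps} → All (λ (ℓ , ts) → length ts ≤ D × All (λ x → Near 5 x ℓ) ts) ps → tokW f ps ≤ locW g ps
      absorbed []                    = z≤n
      absorbed ((|ts| , ts~ℓ) ∷ vs) = +-mono-≤
        (≤-trans (wt-bounded f (All.map (λ {u} → near u) ts~ℓ)) (*-monoˡ-≤ _ |ts|)) (absorbed vs)

    matching : H.Matching S slots
    matching = H.hall (size S) S slots ≤-refl hall-condition

    σ : V → V
    σ = proj₁ matching

    slots≤cap : ∀ b → slots b ≤ cap b
    slots≤cap b = ≤-trans (*-monoʳ-≤ L (occ≤ b)) (≤-trans (≤-reflexive (*-comm L _))
      (χ*≤ (Pos? b) (λ p → ≤-reflexive (sym (pos⇒cap≡L p)))))

    used : Subset n
    used = Vec.tabulate (λ b → does (1 ≤? occ b))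

    ∈-used⁺ : ∀ {b} → 1 ≤ occ b → b ∈ used
    ∈-used⁺ {b} p = lookup⇒[]= b used (trans (lookup∘tabulate _ b) (dec-true (1 ≤? occ b) p))

    ∈-used⁻ : ∀ {b} → b ∈ used → 1 ≤ occ b
    ∈-used⁻ {b} b∈ = decidable-stable (1 ≤? occ b) (λ none →
      contradiction (trans (sym (dec-false (1 ≤? occ b) none)) (trans (sym (lookup∘tabulate _ b)) ([]=⇒lookup b∈))) λ ())

    used⊆S : used ⊆ S
    used⊆S {b} b∈ = proj₁ (decidable-stable (Pos? b) (λ ¬p →
      contradiction (≤-trans (∈-used⁻ b∈) (≤-trans (occ≤ b) (≤-reflexive (χ≡0 (Pos? b) ¬p)))) λ ()))

    ∣used∣≤k : ∣ used ∣ ≤ k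
    ∣used∣≤k = begin
      ∣ used ∣                  ≡⟨ size≡∣∣ used ⟨
      size used                 ≤⟨ ∑-mono (λ b → χ≤ (b ∈? used) ∈-used⁻) ⟩
      ∑ occ                     ≡⟨ sum-cong-≗ {n} (λ b → sym (*-identityʳ (occ b))) ⟩
      ∑ (λ b → occ b * 1)       ≡⟨ locW≡∑ (λ _ → 1) parcels ⟨
      locW (λ _ → 1) parcels    ≡⟨ wt-1 parcels ⟩
      length parcels            ≤⟨ few ⟩
      k                         ∎
      where open ≤-Reasoning

    -- Each `Y u` is at most `D` and they sum to `k * D`; this is the room that `interpolate`
    -- requires.
    k≤∣S∣ : k ≤ ∣ S ∣
    k≤∣S∣ = *-cancelʳ-≤ k ∣ S ∣ D {{ℕ.>-nonZero 0<D}} (begin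
      k * D                           ≡⟨ total ⟨
      ∑ (λ u → χ (u ∈? S) * Y u)      ≤⟨ ∑-mono (λ u → χ*≤ (u ∈? S) (λ u∈ →
          ≤-trans (Y≤D u u∈) (≤-reflexive (sym (χ* (u ∈? S) D u∈))))) ⟩
      ∑ (λ u → χ (u ∈? S) * D)        ≡⟨ *-distribʳ-sum {n} D _ ⟨
      size S * D                      ≡⟨ cong (_* D) (size≡∣∣ S) ⟩
      ∣ S ∣ * D                       ∎)
      where open ≤-Reasoning

    -- Since `u` itself counts towards the load of `σ u`, that vertex has a slot and hence a parcel.
    σ∈used : ∀ u → u ∈ S → σ u ∈ used
    σ∈used u u∈ = ∈-used⁺ (positive (≤-trans
      (≤-reflexive (sym (χ≡1 ((u ∈? S) ×-dec (σ u ≟ σ u)) (u∈ , refl))))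
      (≤-trans (term≤∑ (λ a → χ ((a ∈? S) ×-dec (σ a ≟ σ u))) u) (proj₂ (proj₂ matching) (σ u)))))
      where
      positive : 1 ≤ L * occ (σ u) → 1 ≤ occ (σ u)
      positive p = n≢0⇒n>0 (λ o≡0 → contradiction (≤-trans p (≤-reflexive (trans (cong (L *_) o≡0) (*-zeroʳ L)))) λ ())

    rounding : Σ (Subset n) λ open' → Σ (Fin n → Fin n) λ σ →
      open' ⊆ S × ∣ open' ∣ ≡ k
      × (∀ u → u ∈ S → σ u ∈ open')
      × (∀ u → u ∈ S → DistLe (AdjIn E S) u (σ u) 6)
      × (∀ v → v ∈ open' → countIf n (λ u → (u ∈? S) ×-dec (σ u ≟ v)) ≤ cap v)
    rounding with interpolate used S used⊆S ∣used∣≤k k≤∣S∣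
    ... | T , used⊆T , T⊆S , |T| = T , σ , T⊆S , |T| , (λ u u∈ → used⊆T (σ∈used u u∈)) , proj₁ (proj₂ matching)
      , λ v _ → ≤-trans (≤-reflexive (countIf≡∑ n (λ u → (u ∈? S) ×-dec (σ u ≟ v))))
                        (≤-trans (proj₂ (proj₂ matching) v) (slots≤cap v))

  assignment : (L : ℕ) → ZeroLInstance L cap → Σ (Subset n) λ open' → Σ (Fin n → Fin n) λ σ →
    open' ⊆ S × ∣ open' ∣ ≡ k
    × (∀ u → u ∈ S → σ u ∈ open')
    × (∀ u → u ∈ S → DistLe (AdjIn E S) u (σ u) 6)
    × (∀ v → v ∈ open' → countIf n (λ u → (u ∈? S) ×-dec (σ u ≟ v)) ≤ cap v)
  assignment L zeroL = Rounding.rounding L zeroL transfer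

theorem3 : (n : ℕ) (c : Fin n → Fin n → ℚ) → IsMetric c →
    (L : ℕ) (cap : Fin n → ℕ) → ZeroLInstance L cap →
    (τ : ℚ) → 0ℚ ≤ℚ τ →
    (S : Subset n) → IsComponent (AdjG' c cap τ) S →
    (k : ℕ) → LPFeasible (AdjG' c cap τ) (adjG'? c cap τ) S cap k →
    Σ (Subset n) λ open' → Σ (Fin n → Fin n) λ σ →
    open' ⊆ S × ∣ open' ∣ ≡ k
    × (∀ u → u ∈ S → σ u ∈ open')
    × (∀ u → u ∈ S → DistLe (AdjIn (AdjG' c cap τ) S) u (σ u) 6)
    × (∀ v → v ∈ open' → countIf n (λ u → (u ∈? S) ×-dec (σ u ≟ v)) ≤ cap v)
theorem3 n c metric L cap zeroL τ 0≤τ S component k feasible =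
  Growth.assignment (AdjG' c cap τ) (adjG'? c cap τ) S cap k (integerLP feasible)
    -- Symmetry of the edges comes from that of `c`, and loops from `c u u ≡ 0ℚ` with `0ℚ ≤ τ`;
    -- `proj₂` extracts an endpoint of positive capacity.
    (λ {u} {v} (c≤τ , pos) → subst (_≤ℚ τ) (IsMetric.sym metric u v) c≤τ , Sum.swap pos)
    (λ {u} c≢0 → subst (_≤ℚ τ) (sym (IsMetric.refl0 metric u)) 0≤τ , inj₁ c≢0)
    proj₂ component L zeroL
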